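{- For every nonnegative integer $n$, $$pod(n)=\sum_{j=-\infty}^{\infty}(-1)^j\,a(n-2j^2).$$
   Context: $pod(n)$ denotes the number of partitions of $n$ in which odd parts are distinct and even parts may be repeated, with $pod(0)=1$. $a(n)$ is the cubic partition function: the number of partitions of $n$ in which the even parts can appear in two colors, with $a(0)=1$ and $a(m)=0$ for $m<0$; its generating function is $\sum_{n\ge0}a(n)q^n=\prod_{k\ge1}\frac{1}{(1-q^k)(1-q^{2k})}$. -}

module Defs where

open import Data.Nat using (ℕ; zero; suc; _+_; _*_; _∸_; _≤_; _<_; _>_; _≥_; z≤n; s≤s; z<s; >-nonZero)
import Data.Nat.Properties as ℕ
open import Data.Nat.Divisibility using (_∣_; _∣?_)
open import Data.Nat.ListAction using (sum)
open import Data.Nat.ListAction.Properties using (sum-++)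
open import Data.Integer using (ℤ; -[1+_]; 0ℤ; ∣_∣)
import Data.Integer as ℤ
open import Data.Fin as Fin using (Fin; zero; suc)
import Data.Fin.Properties as Fin
open import Data.List using (List; []; _∷_; [_]; _++_; map; concatMap; filter; length; replicate; upTo)
open import Data.List.Properties using (map-id; ∷-injectiveʳ; ++-cancelˡ)
open import Data.List.Membership.Propositional using (_∈_; _∉_)
open import Data.List.Membership.Propositional.Properties
  using (∈-map⁺; ∈-map⁻; ∈-concat⁺′; ∈-concat⁻′; ∈-upTo⁺; ∈-filter⁺; ∈-filter⁻; ∈-++⁺ˡ; ∈-++⁺ʳ; ∈-++⁻)
open import Data.List.Relation.Unary.Any using (here; there)
open import Data.List.Relation.Unary.All as All using (All; []; _∷_)
import Data.List.Relation.Unary.All.Properties as All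
open import Data.List.Relation.Unary.AllPairs as AllPairs using (AllPairs; []; _∷_)
import Data.List.Relation.Unary.AllPairs.Properties as AllPairs
open import Data.List.Relation.Unary.Unique.Propositional using (Unique)
import Data.List.Relation.Unary.Unique.Propositional.Properties as Unique
open import Data.List.Relation.Unary.Unique.DecPropositional ℕ._≟_ using (unique?)
open import Data.Product using (∃-syntax; _×_; _,_; proj₁; proj₂)
open import Data.Product.Relation.Binary.Lex.Strict using (×-Lex)
open import Data.Sum using (_⊎_; inj₁; inj₂)
open import Data.Empty using (⊥-elim)
open import Relation.Nullary using (¬_; yes; no; ¬?)
open import Relation.Unary using (Pred; Decidable)
open import Relation.Binary using (Rel; Antisymmetric; Reflexive)
open import Relation.Binary.PropositionalEquality using (_≡_; _≢_; refl; sym; trans; cong; subst)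
open import Level using (0ℓ)

-- A predicate P with finitely many solutions, all listed without repetition.
record Finite {A : Set} (P : Pred A 0ℓ) : Set where
  field
    elements : List A
    unique   : Unique elements
    sound    : ∀ {x} → x ∈ elements → P x
    complete : ∀ {x} → P x → x ∈ elements

card : ∀ {A : Set} {P : Pred A 0ℓ} → Finite P → ℕ
card F = length (Finite.elements F)

module _ {A : Set} {P Q : Pred A 0ℓ} where

  Finite-resp : (∀ {x} → P x → Q x) → (∀ {x} → Q x → P x) → Finite P → Finite Q
  Finite-resp to from F = record
    { elements = elements ; unique = unique
    ; sound = λ x∈ → to (sound x∈) ; complete = λ q → complete (from q) }
    where open Finite F

  Finite-filter : Decidable Q → Finite P → Finite (λ x → P x × Q x)
  Finite-filter Q? F = record
    { elements = filter Q? elements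
    ; unique   = Unique.filter⁺ Q? unique
    ; sound    = λ x∈ → let (x∈xs , q) = ∈-filter⁻ Q? {xs = elements} x∈ in sound x∈xs , q
    ; complete = λ (p , q) → ∈-filter⁺ Q? (complete p) q }
    where open Finite F

-- Multisets of total size n of elements of the list ps, each written as a list
-- in which equal elements are adjacent and the order of ps is kept.
module Multisets {A : Set} (size : A → ℕ) where

  multisets : List A → ℕ → List (List A)
  extend : A → List A → ℕ → ℕ → List (List A)

  multisets []       zero    = [ [] ]
  multisets []       (suc n) = []
  multisets (p ∷ ps) n       = concatMap (extend p ps n) (filter (λ k → k * size p ℕ.≤? n) (upTo (suc n)))

  extend p ps n k = map (replicate k p ++_) (multisets ps (n ∸ k * size p))

  module _ {_≽_ : Rel A 0ℓ} (≽-refl : Reflexive _≽_) (≽-antisym : Antisymmetric _≡_ _≽_) where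

    IsMultiset : List A → ℕ → Pred (List A) 0ℓ
    IsMultiset ps n xs = AllPairs _≽_ xs × All (_∈ ps) xs × sum (map size xs) ≡ n

    private
      sum-replicate-++ : ∀ k p ys →
        sum (map size (replicate k p ++ ys)) ≡ k * size p + sum (map size ys)
      sum-replicate-++ zero    p ys = refl
      sum-replicate-++ (suc k) p ys =
        trans (cong (size p +_) (sum-replicate-++ k p ys)) (sym (ℕ.+-assoc (size p) _ _))

      sorted-replicate-++ : ∀ k {p ys} → All (p ≽_) ys → AllPairs _≽_ ys →
                            AllPairs _≽_ (replicate k p ++ ys)
      sorted-replicate-++ zero    p≽ys s = s
      sorted-replicate-++ (suc k) p≽ys s =
        All.++⁺ (All.replicate⁺ k ≽-refl) p≽ys ∷ sorted-replicate-++ k p≽ys s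

      drop-head : ∀ {p : A} {ps ys} → p ∉ ys → All (_∈ (p ∷ ps)) ys → All (_∈ ps) ys
      drop-head p∉ []              = []
      drop-head p∉ (here refl ∷ _) = ⊥-elim (p∉ (here refl))
      drop-head p∉ (there y∈ ∷ a)  = y∈ ∷ drop-head (λ p∈ → p∉ (there p∈)) a

      split : ∀ {p ps} → All (p ≽_) ps → p ∉ ps → ∀ xs → AllPairs _≽_ xs → All (_∈ (p ∷ ps)) xs →
              ∃[ k ] ∃[ ys ] (xs ≡ replicate k p ++ ys × AllPairs _≽_ ys × All (_∈ ps) ys)
      split p≽ p∉ [] [] [] = 0 , [] , refl , [] , []
      split p≽ p∉ (x ∷ xs) (_ ∷ s) (here refl ∷ a) =
        let (k , ys , eq , s′ , a′) = split p≽ p∉ xs s a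
        in suc k , ys , cong (x ∷_) eq , s′ , a′
      split {p} {ps} p≽ p∉ (x ∷ xs) (x≽ ∷ s) (there x∈ ∷ a) =
        0 , x ∷ xs , refl , x≽ ∷ s , x∈ ∷ drop-head p∉xs a
        where
        p∉xs : p ∉ xs
        p∉xs p∈ = p∉ (subst (_∈ ps) (≽-antisym (All.lookup x≽ p∈) (All.lookup p≽ x∈)) x∈)

      replicate-injective : ∀ k l {p : A} {ys zs} → p ∉ ys → p ∉ zs →
                            replicate k p ++ ys ≡ replicate l p ++ zs → k ≡ l
      replicate-injective zero    zero    p∉ys p∉zs eq   = refl
      replicate-injective zero    (suc l) p∉ys p∉zs refl = ⊥-elim (p∉ys (here refl))
      replicate-injective (suc k) zero    p∉ys p∉zs refl = ⊥-elim (p∉zs (here refl))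
      replicate-injective (suc k) (suc l) p∉ys p∉zs eq   =
        cong suc (replicate-injective k l p∉ys p∉zs (∷-injectiveʳ eq))

    multisets-sound : ∀ {ps n xs} → AllPairs _≽_ ps → xs ∈ multisets ps n → IsMultiset ps n xs
    multisets-sound {[]} {zero} _ (here refl) = [] , [] , refl
    multisets-sound {p ∷ ps} {n} {xs} (p≽ ∷ s) xs∈
      with ∈-concat⁻′ (map (extend p ps n) _) xs∈
    ... | _ , xs∈yss , yss∈ with ∈-map⁻ (extend p ps n) yss∈
    ... | k , k∈ , refl with ∈-map⁻ (replicate k p ++_) xs∈yss
    ... | ys , ys∈ , refl with multisets-sound s ys∈
    ... | sys , ays , eq =
        sorted-replicate-++ k (All.map (All.lookup p≽) ays) sys
      , All.++⁺ (All.replicate⁺ k (here refl)) (All.map there ays)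
      , trans (sum-replicate-++ k p ys) (trans (cong (k * size p +_) eq) (ℕ.m+[n∸m]≡n k≤))
      where
      k≤ : k * size p ≤ n
      k≤ = proj₂ (∈-filter⁻ (λ k → k * size p ℕ.≤? n) {xs = upTo (suc n)} k∈)

    multisets-complete : ∀ {ps n xs} → AllPairs _≽_ ps → Unique ps → All (λ p → 0 < size p) ps →
                         IsMultiset ps n xs → xs ∈ multisets ps n
    multisets-complete {[]} {xs = []} _ _ _ (_ , _ , refl) = here refl
    multisets-complete {[]} {xs = x ∷ xs} _ _ _ (_ , () ∷ _ , _)
    multisets-complete {p ∷ ps} {n} {xs} (p≽ ∷ s) u@(_ ∷ us) (0<p ∷ 0<ps) (sxs , axs , eq)
      with split p≽ (Unique.Unique[x∷xs]⇒x∉xs u) xs sxs axs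
    ... | k , ys , refl , sys , ays =
      ∈-concat⁺′ (∈-map⁺ (replicate k p ++_) ys∈)
        (∈-map⁺ (extend p ps n) (∈-filter⁺ (λ k → k * size p ℕ.≤? n) (∈-upTo⁺ (s≤s k≤n)) k*p≤n))
      where
      eq′ : k * size p + sum (map size ys) ≡ n
      eq′ = trans (sym (sum-replicate-++ k p ys)) eq
      k*p≤n : k * size p ≤ n
      k*p≤n = ℕ.≤-trans (ℕ.m≤m+n _ _) (ℕ.≤-reflexive eq′)
      k≤n : k ≤ n
      k≤n = ℕ.≤-trans (ℕ.m≤m*n k (size p) {{>-nonZero 0<p}}) k*p≤n
      ys∈ : ys ∈ multisets ps (n ∸ k * size p)
      ys∈ = multisets-complete s us 0<ps
        (sys , ays , trans (sym (ℕ.m+n∸m≡n (k * size p) _)) (cong (_∸ k * size p) eq′))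

    multisets-unique : ∀ {ps} n → AllPairs _≽_ ps → Unique ps → Unique (multisets ps n)
    multisets-unique {[]} zero    _ _ = [] ∷ []
    multisets-unique {[]} (suc n) _ _ = []
    multisets-unique {p ∷ ps} n (_ ∷ s) u@(_ ∷ us) = Unique.concat⁺
      (All.map⁺ (All.universal
        (λ k → Unique.map⁺ (λ {ys} {zs} → ++-cancelˡ (replicate k p) ys zs)
                 (multisets-unique (n ∸ k * size p) s us)) ks))
      (AllPairs.map⁺ (AllPairs.map disjoint
        (Unique.filter⁺ (λ k → k * size p ℕ.≤? n) (Unique.upTo⁺ (suc n)))))
      where
      ks : List ℕ
      ks = filter (λ k → k * size p ℕ.≤? n) (upTo (suc n))
      p∉ : ∀ {m ys} → ys ∈ multisets ps m → p ∉ ys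
      p∉ ys∈ p∈ = Unique.Unique[x∷xs]⇒x∉xs u (All.lookup (proj₁ (proj₂ (multisets-sound s ys∈))) p∈)
      disjoint : ∀ {k l} → k ≢ l → ∀ {xs} → ¬ (xs ∈ extend p ps n k × xs ∈ extend p ps n l)
      disjoint {k} {l} k≢l (xs∈k , xs∈l)
        with ∈-map⁻ (replicate k p ++_) xs∈k | ∈-map⁻ (replicate l p ++_) xs∈l
      ... | ys , ys∈ , eq₁ | zs , zs∈ , eq₂ =
        k≢l (replicate-injective k l (p∉ ys∈) (p∉ zs∈) (trans (sym eq₁) eq₂))

    multisets-finite : ∀ {ps} n → AllPairs _≽_ ps → Unique ps → All (λ p → 0 < size p) ps →
                       Finite (IsMultiset ps n)
    multisets-finite {ps} n s u pos = record
      { elements = multisets ps n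
      ; unique   = multisets-unique n s u
      ; sound    = multisets-sound s
      ; complete = multisets-complete s u pos }

open Multisets public using (multisets)

IsPartition : ℕ → Pred (List ℕ) 0ℓ
IsPartition n xs = AllPairs _≥_ xs × All (0 <_) xs × sum xs ≡ n

parts : ℕ → List ℕ
parts zero    = []
parts (suc n) = suc n ∷ parts n

parts-sound : ∀ n {k} → k ∈ parts n → 0 < k × k ≤ n
parts-sound (suc n) (here refl) = z<s , ℕ.≤-refl
parts-sound (suc n) (there k∈)  = let (p , q) = parts-sound n k∈ in p , ℕ.m≤n⇒m≤1+n q

parts-complete : ∀ n {k} → 0 < k → k ≤ n → k ∈ parts n
parts-complete zero    0<k k≤0 = ⊥-elim (ℕ.<-irrefl refl (ℕ.<-≤-trans 0<k k≤0))
parts-complete (suc n) 0<k k≤1+n with ℕ.m≤n⇒m<n∨m≡n k≤1+n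
... | inj₁ (s≤s k≤n) = there (parts-complete n 0<k k≤n)
... | inj₂ refl      = here refl

parts-decreasing : ∀ n → AllPairs _>_ (parts n)
parts-decreasing zero    = []
parts-decreasing (suc n) = All.tabulate (λ k∈ → s≤s (proj₂ (parts-sound n k∈))) ∷ parts-decreasing n

All-≤-sum : ∀ xs → All (_≤ sum xs) xs
All-≤-sum []       = []
All-≤-sum (x ∷ xs) = ℕ.m≤m+n x _ ∷ All.map (λ y≤ → ℕ.≤-trans y≤ (ℕ.m≤n+m _ x)) (All-≤-sum xs)

partitions : ∀ n → Finite (IsPartition n)
partitions n = Finite-resp
  (λ {xs} (s , a , eq) → s , All.map (λ k∈ → proj₁ (parts-sound n k∈)) a
                       , trans (cong sum (sym (map-id xs))) eq)
  (λ {xs} (s , a , eq) → s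
     , All.zipWith (λ (0<k , k≤) → parts-complete n 0<k (ℕ.≤-trans k≤ (ℕ.≤-reflexive eq))) (a , All-≤-sum xs)
     , trans (cong sum (map-id xs)) eq)
  (Multisets.multisets-finite (λ k → k) {_≥_} ℕ.≤-refl (λ p q → ℕ.≤-antisym q p) n
    (AllPairs.map ℕ.<⇒≤ (parts-decreasing n))
    (AllPairs.map ℕ.>⇒≢ (parts-decreasing n))
    (All.tabulate (λ k∈ → proj₁ (parts-sound n k∈))))

OddPartsDistinct : Pred (List ℕ) 0ℓ
OddPartsDistinct xs = Unique (filter (λ k → ¬? (2 ∣? k)) xs)

oddPartsDistinct? : Decidable OddPartsDistinct
oddPartsDistinct? xs = unique? (filter (λ k → ¬? (2 ∣? k)) xs)

podPartitions : ∀ n → Finite (λ xs → IsPartition n xs × OddPartsDistinct xs)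
podPartitions n = Finite-filter oddPartsDistinct? (partitions n)

pod : ℕ → ℕ
pod n = card (podPartitions n)

-- A coloured part is a part together with one of two colours; only the even
-- parts are allowed to have colour 1.
ColouredPart : Set
ColouredPart = ℕ × Fin 2

Admissible : Pred ColouredPart 0ℓ
Admissible (k , c) = 0 < k × (c ≡ zero ⊎ 2 ∣ k)

-- Only used to write each multiset of coloured parts as a list in one way.
_≽_ : Rel ColouredPart 0ℓ
_≽_ = ×-Lex _≡_ _>_ Fin._≥_

IsCubicPartition : ℕ → Pred (List ColouredPart) 0ℓ
IsCubicPartition n xs = AllPairs _≽_ xs × All Admissible xs × sum (map proj₁ xs) ≡ n

≽-refl : Reflexive _≽_
≽-refl = inj₂ (refl , ℕ.≤-refl)

≽-antisym : Antisymmetric _≡_ _≽_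
≽-antisym (inj₁ p)          (inj₁ q)          = ⊥-elim (ℕ.<-asym p q)
≽-antisym (inj₁ p)          (inj₂ (refl , _)) = ⊥-elim (ℕ.<-irrefl refl p)
≽-antisym (inj₂ (refl , _)) (inj₁ q)          = ⊥-elim (ℕ.<-irrefl refl q)
≽-antisym (inj₂ (refl , p)) (inj₂ (_ , q))    = cong (_ ,_) (Fin.≤-antisym q p)

coloursOf : ℕ → List ColouredPart
coloursOf k with 2 ∣? k
... | yes _ = (k , suc zero) ∷ (k , zero) ∷ []
... | no  _ = (k , zero) ∷ []

colouredParts : ℕ → List ColouredPart
colouredParts zero    = []
colouredParts (suc n) = coloursOf (suc n) ++ colouredParts n

coloursOf-sound : ∀ k {x} → x ∈ coloursOf k → proj₁ x ≡ k × (proj₂ x ≡ zero ⊎ 2 ∣ k)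
coloursOf-sound k x∈ with 2 ∣? k
coloursOf-sound k (here refl)         | yes 2∣k = refl , inj₂ 2∣k
coloursOf-sound k (there (here refl)) | yes 2∣k = refl , inj₁ refl
coloursOf-sound k (here refl)         | no  _   = refl , inj₁ refl

coloursOf-complete : ∀ k {c} → c ≡ zero ⊎ 2 ∣ k → (k , c) ∈ coloursOf k
coloursOf-complete k {c} p with 2 ∣? k
coloursOf-complete k {zero}     p           | yes _ = there (here refl)
coloursOf-complete k {suc zero} p           | yes _ = here refl
coloursOf-complete k            (inj₁ refl) | no _  = here refl
coloursOf-complete k            (inj₂ 2∣k)  | no ¬2∣k = ⊥-elim (¬2∣k 2∣k)

_≻_ : Rel ColouredPart 0ℓ
x ≻ y = x ≽ y × x ≢ y

coloursOf-decreasing : ∀ k → AllPairs _≻_ (coloursOf k)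
coloursOf-decreasing k with 2 ∣? k
... | yes _ = ((inj₂ (refl , z≤n) , λ ()) ∷ []) ∷ [] ∷ []
... | no  _ = [] ∷ []

colouredParts-sound : ∀ n {x} → x ∈ colouredParts n → Admissible x × proj₁ x ≤ n
colouredParts-sound (suc n) x∈ with ∈-++⁻ (coloursOf (suc n)) x∈
... | inj₂ x∈′ = let (p , q) = colouredParts-sound n x∈′ in p , ℕ.m≤n⇒m≤1+n q
... | inj₁ x∈′ with coloursOf-sound (suc n) x∈′
...   | refl , p = (z<s , p) , ℕ.≤-refl

colouredParts-complete : ∀ n {x} → Admissible x → proj₁ x ≤ n → x ∈ colouredParts n
colouredParts-complete zero (0<k , _) k≤0 = ⊥-elim (ℕ.<-irrefl refl (ℕ.<-≤-trans 0<k k≤0))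
colouredParts-complete (suc n) adm@(_ , p) k≤1+n with ℕ.m≤n⇒m<n∨m≡n k≤1+n
... | inj₁ (s≤s k≤n) = ∈-++⁺ʳ (coloursOf (suc n)) (colouredParts-complete n adm k≤n)
... | inj₂ refl      = ∈-++⁺ˡ (coloursOf-complete (suc n) p)

colouredParts-decreasing : ∀ n → AllPairs _≻_ (colouredParts n)
colouredParts-decreasing zero    = []
colouredParts-decreasing (suc n) = AllPairs.++⁺ (coloursOf-decreasing (suc n)) (colouredParts-decreasing n)
  (All.tabulate (λ x∈ → All.tabulate (λ y∈ → above x∈ y∈)))
  where
  above : ∀ {x y} → x ∈ coloursOf (suc n) → y ∈ colouredParts n → x ≻ y
  above x∈ y∈ with coloursOf-sound (suc n) x∈ | proj₂ (colouredParts-sound n y∈)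
  ... | refl , _ | y≤n = inj₁ (s≤s y≤n) , λ { refl → ℕ.1+n≰n y≤n }

cubicPartitions : ∀ n → Finite (IsCubicPartition n)
cubicPartitions n = Finite-resp
  (λ (s , a , eq) → s , All.map (λ x∈ → proj₁ (colouredParts-sound n x∈)) a , eq)
  (λ {xs} (s , a , eq) → s
     , All.zipWith (λ (adm , k≤) → colouredParts-complete n adm (ℕ.≤-trans k≤ (ℕ.≤-reflexive eq)))
         (a , All.map⁻ (All-≤-sum (map proj₁ xs)))
     , eq)
  (Multisets.multisets-finite proj₁ {_≽_} (λ {x} → ≽-refl {x}) ≽-antisym n
    (AllPairs.map proj₁ (colouredParts-decreasing n))
    (AllPairs.map proj₂ (colouredParts-decreasing n))
    (All.tabulate (λ x∈ → proj₁ (proj₁ (colouredParts-sound n x∈)))))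

a : ℤ → ℕ
a (ℤ.+ n)  = card (cubicPartitions n)
a -[1+ _ ] = 0

-- f(-N) + … + f(N)
sumUpTo : ℕ → (ℤ → ℤ) → ℤ
sumUpTo zero    f = f 0ℤ
sumUpTo (suc N) f = sumUpTo N f ℤ.+ (f (ℤ.+ suc N) ℤ.+ f -[1+ N ])

-- f has finite support and s is the sum of its values over all of ℤ.
_SumsTo_ : (ℤ → ℤ) → ℤ → Set
f SumsTo s = ∃[ N ] ((∀ j → N < ∣ j ∣ → f j ≡ 0ℤ) × sumUpTo N f ≡ s)

{-# OPTIONS --safe #-}

-- The generating functions satisfy pod = ∏ (1 + q²ᵏ⁻¹)/(1 − q²ᵏ) and a = ∏ 1/((1 − qᵏ)(1 − q²ᵏ)), and
-- Gauss's identity gives Σⱼ (−1)ʲ xʲ² = ∏ (1 − xᵏ)/(1 + xᵏ). At x = q² their combination is Euler's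
-- identity ∏ (1 − x²ᵏ⁻¹)(1 + xᵏ) = 1. Gauss's identity follows from the polynomial identity (after Shanks)
--   ∏_{1≤i≤n} (1 + xⁱ) · Σ_{|j|≤n} (−1)ʲ xʲ²
--     = Σ_{0≤k≤n} (−1)ᵏ xᵏ⁽ⁿ⁺¹⁾ ∏_{0≤i<k} (1 + xⁱ) ∏_{k<i≤n} (1 − xⁱ),
-- whose right-hand side telescopes from n − 1 to n and only has the term k = 0 modulo xⁿ⁺¹.
-- All this takes place modulo a power of q, where the infinite products are finite.
module Submission where

open import Defs
open import Data.Nat using (ℕ)
open import Data.Integer using (ℤ; +_; _-_; _*_; _^_; -1ℤ; ∣_∣)

open import Algebra.Bundles using (CommutativeRing)
import Algebra.Properties.CommutativeSemiring.Exp
import Algebra.Solver.Ring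
open import Algebra.Solver.Ring.AlmostCommutativeRing
  using (fromCommutativeRing; Induced-equivalence; _-Raw-AlmostCommutative⟶_)
open import Algebra.Structures using (IsCommutativeRing)
open import Data.Bool using (if_then_else_; true; false)
open import Data.Empty using (⊥-elim)
open import Data.Fin using (zero; suc)
open import Data.Integer using (-[1+_]; 0ℤ; 1ℤ)
import Data.Integer as ℤ
import Data.Integer.Properties as ℤ
open import Data.Integer.Solver using (module +-*-Solver)
open import Data.List using (List; []; _∷_; _++_; map; concatMap; filter; length; replicate; upTo; applyUpTo)
open import Data.List.Membership.Propositional using (_∉_)
open import Data.List.Membership.Propositional.Properties using (∈-filter⁻)
open import Data.List.Properties
  using (map-id; map-upTo; length-++; length-map; filter-++; filter-accept; filter-reject; filter-none)
open import Data.List.Relation.Unary.All as All using (All; []; _∷_)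
import Data.List.Relation.Unary.All.Properties as All
open import Data.List.Relation.Unary.AllPairs as AllPairs using ([]; _∷_)
open import Data.List.Relation.Unary.Unique.Propositional using (Unique)
open import Data.Nat using (zero; suc; _≤_; _<_; z≤n; s≤s; z<s; _∸_)
import Data.Nat as ℕ
open import Data.Nat.Divisibility using (_∣_; _∣?_; divides; ∣m+n∣m⇒∣n; ∣1⇒≡1)
open import Data.Nat.ListAction using (sum)
import Data.Nat.Properties as ℕ
open import Data.Product using (_,_; proj₁; proj₂; ∃-syntax)
open import Data.Sum using (_⊎_; inj₁; inj₂)
open import Function using (_∘_; id; _⇔_; mk⇔; Equivalence)
open import Level using (0ℓ)
open import Relation.Binary using (IsEquivalence; WeaklyDecidable) renaming (Decidable to Decidable₂)
open import Relation.Binary.Consequences using (dec⇒weaklyDec)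
open import Relation.Binary.PropositionalEquality
  using (_≡_; _≗_; refl; sym; trans; cong; cong₂; subst; module ≡-Reasoning)
import Relation.Binary.Reasoning.Setoid
open import Relation.Nullary using (¬_; yes; no; does; ¬?)
open import Relation.Nullary.Decidable using (dec-true; dec-false; map′)
open import Relation.Unary using (Pred; Decidable)

-- Formal power series with integer coefficients.

Series : Set
Series = ℕ → ℤ

tail : Series → Series
tail f n = f (suc n)

const : ℤ → Series
const c zero    = c
const c (suc _) = 0ℤ

infixl 6 _⊕_
infixl 7 _⊗_
infix  8 ⊝_

_⊕_ : Series → Series → Series
(f ⊕ g) n = f n ℤ.+ g n

⊝_ : Series → Series
(⊝ f) n = ℤ.- f n

-- The Cauchy product, unfolded by f = f 0 + q · `tail f`. Recursion on the coefficient index lets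
-- the ring laws be proved by induction, without finite sums.
_⊗_ : Series → Series → Series
(f ⊗ g) zero    = f 0 * g 0
(f ⊗ g) (suc n) = f 0 * g (suc n) ℤ.+ (tail f ⊗ g) n

q : Series
q zero    = 0ℤ
q (suc n) = const 1ℤ n

-- Coefficient n of a product involves only coefficients up to n of the factors. This makes equality
-- modulo a power of q compatible with multiplication.
⊗-cong-≤ : ∀ n {f f′ g g′} → (∀ {i} → i ≤ n → f i ≡ f′ i) → (∀ {i} → i ≤ n → g i ≡ g′ i) →
           (f ⊗ g) n ≡ (f′ ⊗ g′) n
⊗-cong-≤ zero    f≈ g≈ = cong₂ _*_ (f≈ z≤n) (g≈ z≤n)
⊗-cong-≤ (suc n) f≈ g≈ = cong₂ ℤ._+_ (cong₂ _*_ (f≈ z≤n) (g≈ ℕ.≤-refl))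
  (⊗-cong-≤ n (f≈ ∘ s≤s) (g≈ ∘ ℕ.m≤n⇒m≤1+n))

⊗-distribˡ : ∀ f g h → f ⊗ (g ⊕ h) ≗ f ⊗ g ⊕ f ⊗ h
⊗-distribˡ f g h zero    = ℤ.*-distribˡ-+ (f 0) (g 0) (h 0)
⊗-distribˡ f g h (suc n) = trans (cong (λ z → f 0 * (g (suc n) ℤ.+ h (suc n)) ℤ.+ z) (⊗-distribˡ (tail f) g h n))
  (solve 5 (λ a b c d e → a :* (b :+ c) :+ (d :+ e) := (a :* b :+ d) :+ (a :* c :+ e)) refl
    (f 0) (g (suc n)) (h (suc n)) _ _)
  where open +-*-Solver

⊗-distribʳ : ∀ f g h → (g ⊕ h) ⊗ f ≗ g ⊗ f ⊕ h ⊗ f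
⊗-distribʳ f g h zero    = ℤ.*-distribʳ-+ (f 0) (g 0) (h 0)
⊗-distribʳ f g h (suc n) = trans (cong (λ z → (g 0 ℤ.+ h 0) * f (suc n) ℤ.+ z) (⊗-distribʳ f (tail g) (tail h) n))
  (solve 5 (λ a b c d e → (b :+ c) :* a :+ (d :+ e) := (b :* a :+ d) :+ (c :* a :+ e)) refl
    (f (suc n)) (g 0) (h 0) _ _)
  where open +-*-Solver

scale-⊗ : ∀ c f g → (λ n → c * f n) ⊗ g ≗ (λ n → c * (f ⊗ g) n)
scale-⊗ c f g zero    = ℤ.*-assoc c (f 0) (g 0)
scale-⊗ c f g (suc n) = trans (cong (λ z → c * f 0 * g (suc n) ℤ.+ z) (scale-⊗ c (tail f) g n))
  (solve 4 (λ a b c d → a :* b :* c :+ a :* d := a :* (b :* c :+ d)) refl c (f 0) (g (suc n)) _)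
  where open +-*-Solver

⊗-assoc : ∀ f g h → (f ⊗ g) ⊗ h ≗ f ⊗ (g ⊗ h)
⊗-assoc f g h zero    = ℤ.*-assoc (f 0) (g 0) (h 0)
⊗-assoc f g h (suc n) = begin
  f 0 * g 0 * h (suc n) ℤ.+ (((λ n → f 0 * tail g n) ⊕ (tail f ⊗ g)) ⊗ h) n
    ≡⟨ cong (λ z → f 0 * g 0 * h (suc n) ℤ.+ z) (begin
         _ ≡⟨ ⊗-distribʳ h (λ n → f 0 * tail g n) (tail f ⊗ g) n ⟩
         _ ≡⟨ cong₂ ℤ._+_ (scale-⊗ (f 0) (tail g) h n) (⊗-assoc (tail f) g h n) ⟩
         f 0 * (tail g ⊗ h) n ℤ.+ (tail f ⊗ (g ⊗ h)) n ∎) ⟩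
  f 0 * g 0 * h (suc n) ℤ.+ (f 0 * (tail g ⊗ h) n ℤ.+ (tail f ⊗ (g ⊗ h)) n)
    ≡⟨ solve 5 (λ a b c d e → a :* b :* c :+ (a :* d :+ e) := a :* (b :* c :+ d) :+ e) refl
         (f 0) (g 0) (h (suc n)) ((tail g ⊗ h) n) ((tail f ⊗ (g ⊗ h)) n) ⟩
  f 0 * (g 0 * h (suc n) ℤ.+ (tail g ⊗ h) n) ℤ.+ (tail f ⊗ (g ⊗ h)) n ∎
  where
  open ≡-Reasoning
  open +-*-Solver

-- The mirror image of the defining recursion, peeling the right factor instead of the left;
-- commutativity matches the two.
⊗-sucʳ : ∀ f g n → (f ⊗ g) (suc n) ≡ g 0 * f (suc n) ℤ.+ (f ⊗ tail g) n
⊗-sucʳ f g zero    =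
  solve 4 (λ a b c d → a :* b :+ c :* d := d :* c :+ a :* b) refl (f 0) (g 1) (f 1) (g 0)
  where open +-*-Solver
⊗-sucʳ f g (suc n) = trans (cong (λ z → f 0 * g (suc (suc n)) ℤ.+ z) (⊗-sucʳ (tail f) g n))
  (solve 3 (λ a b c → a :+ (b :+ c) := b :+ (a :+ c)) refl
    (f 0 * g (suc (suc n))) (g 0 * f (suc (suc n))) _)
  where open +-*-Solver

⊗-comm : ∀ f g → f ⊗ g ≗ g ⊗ f
⊗-comm f g zero    = ℤ.*-comm (f 0) (g 0)
⊗-comm f g (suc n) = trans (cong (λ z → f 0 * g (suc n) ℤ.+ z) (⊗-comm (tail f) g n)) (sym (⊗-sucʳ g f n))

const-⊗ : ∀ c f → const c ⊗ f ≗ (λ n → c * f n)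
const-⊗ c f zero    = refl
const-⊗ c f (suc n) = trans (cong (λ z → c * f (suc n) ℤ.+ z) (zero-⊗ n)) (ℤ.+-identityʳ _)
  where
  zero-⊗ : ∀ n → ((λ _ → 0ℤ) ⊗ f) n ≡ 0ℤ
  zero-⊗ zero    = refl
  zero-⊗ (suc n) = trans (ℤ.+-identityˡ _) (zero-⊗ n)

⊗-identityˡ : ∀ f → const 1ℤ ⊗ f ≗ f
⊗-identityˡ f n = trans (const-⊗ 1ℤ f n) (ℤ.*-identityˡ (f n))

-- The power series ring modulo q^(1+N).
module Truncated (N : ℕ) where

  infix 4 _≈_

  -- A record rather than a bare function type, so that `f` and `g` can be recovered from the type
  -- `f ≈ g`.
  record _≈_ (f g : Series) : Set where
    constructor mk≈
    field coeff : ∀ {i} → i ≤ N → f i ≡ g i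

  open _≈_ public

  ≗⇒≈ : ∀ {f g} → f ≗ g → f ≈ g
  ≗⇒≈ f≗g = mk≈ λ {i} _ → f≗g i

  private
    ≈-isEquivalence : IsEquivalence _≈_
    ≈-isEquivalence = record
      { refl  = mk≈ λ _ → refl
      ; sym   = λ p → mk≈ λ i≤ → sym (coeff p i≤)
      ; trans = λ p q → mk≈ λ i≤ → trans (coeff p i≤) (coeff q i≤)
      }

  ⊗-cong : ∀ {f f′ g g′} → f ≈ f′ → g ≈ g′ → f ⊗ g ≈ f′ ⊗ g′
  ⊗-cong p r = mk≈ λ {i} i≤ → ⊗-cong-≤ i (λ j≤ → coeff p (ℕ.≤-trans j≤ i≤)) (λ j≤ → coeff r (ℕ.≤-trans j≤ i≤))

  isCommutativeRing : IsCommutativeRing _≈_ _⊕_ _⊗_ ⊝_ (const 0ℤ) (const 1ℤ)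
  isCommutativeRing = record
    { isRing = record
      { +-isAbelianGroup = record
        { isGroup = record
          { isMonoid = record
            { isSemigroup = record
              { isMagma = record
                { isEquivalence = ≈-isEquivalence
                ; ∙-cong = λ p r → mk≈ λ i≤ → cong₂ ℤ._+_ (coeff p i≤) (coeff r i≤) }
              ; assoc = λ f g h → ≗⇒≈ λ n → ℤ.+-assoc (f n) (g n) (h n) }
            ; identity = (λ f → ≗⇒≈ λ { zero → ℤ.+-identityˡ _ ; (suc n) → ℤ.+-identityˡ _ })
                       , (λ f → ≗⇒≈ λ { zero → ℤ.+-identityʳ _ ; (suc n) → ℤ.+-identityʳ _ }) }
          ; inverse = (λ f → ≗⇒≈ λ { zero → ℤ.+-inverseˡ (f 0) ; (suc n) → ℤ.+-inverseˡ (f (suc n)) })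
                    , (λ f → ≗⇒≈ λ { zero → ℤ.+-inverseʳ (f 0) ; (suc n) → ℤ.+-inverseʳ (f (suc n)) })
          ; ⁻¹-cong = λ p → mk≈ λ i≤ → cong ℤ.-_ (coeff p i≤) }
        ; comm = λ f g → ≗⇒≈ λ n → ℤ.+-comm (f n) (g n) }
      ; *-cong = ⊗-cong
      ; *-assoc = λ f g h → ≗⇒≈ (⊗-assoc f g h)
      ; *-identity = (λ f → ≗⇒≈ (⊗-identityˡ f))
                   , (λ f → ≗⇒≈ λ n → trans (⊗-comm f (const 1ℤ) n) (⊗-identityˡ f n))
      ; distrib = (λ f g h → ≗⇒≈ (⊗-distribˡ f g h)) , (λ f g h → ≗⇒≈ (⊗-distribʳ f g h)) }
    ; *-comm = λ f g → ≗⇒≈ (⊗-comm f g) }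

  commutativeRing : CommutativeRing 0ℓ 0ℓ
  commutativeRing = record { isCommutativeRing = isCommutativeRing }

  open CommutativeRing commutativeRing public using (setoid; commutativeSemiring)
    renaming ( refl to ≈-refl; sym to ≈-sym; trans to ≈-trans; reflexive to ≈-reflexive
             ; +-cong to ⊕-cong; -‿cong to ⊝-cong)
  open Algebra.Properties.CommutativeSemiring.Exp commutativeSemiring public
    using () renaming (_^_ to _↑_; ^-homo-* to ↑-homo-⊗; ^-assocʳ to ↑-assocʳ; ^-distrib-* to ↑-distrib-⊗)

  private
    constants : CommutativeRing.rawRing ℤ.+-*-commutativeRing
                -Raw-AlmostCommutative⟶ fromCommutativeRing commutativeRing
    constants = record
      { ⟦_⟧    = const
      ; +-homo = λ a b → ≗⇒≈ λ { zero → refl ; (suc n) → refl }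
      ; *-homo = λ a b → ≗⇒≈ λ { zero → refl ; (suc n) → sym (trans (const-⊗ a (const b) (suc n)) (ℤ.*-zeroʳ a)) }
      ; -‿homo = λ a → ≗⇒≈ λ { zero → refl ; (suc n) → refl }
      ; 0-homo = ≈-refl
      ; 1-homo = ≈-refl }

    _≟const_ : Decidable₂ (Induced-equivalence constants)
    -- Coefficient 0 survives every truncation, so constant series that agree modulo q^(1+N) come
    -- from equal integers.
    a ≟const b = map′ (λ { refl → ≈-refl }) (λ p → coeff p z≤n) (a ℤ.≟ b)

    ≟const-weakly : WeaklyDecidable (Induced-equivalence constants)
    ≟const-weakly = dec⇒weaklyDec _≟const_

  module Solver = Algebra.Solver.Ring _ _ constants ≟const-weakly

-- Gauss's and Euler's identities for truncated series.

𝟘 𝟙 : Series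
𝟘 = const 0ℤ
𝟙 = const 1ℤ

sgn : ℕ → Series
sgn n = const (-1ℤ ^ n)

∏< : ℕ → (ℕ → Series) → Series
∏< zero    f = 𝟙
∏< (suc n) f = ∏< n f ⊗ f n

n*2≡n+n : ∀ n → n ℕ.* 2 ≡ n ℕ.+ n
n*2≡n+n n = trans (ℕ.*-comm n 2) (cong (n ℕ.+_) (ℕ.+-identityʳ n))

module Gauss (N : ℕ) where
  open Truncated N
  open Relation.Binary.Reasoning.Setoid setoid
  open Solver using (solve; con; _:+_; _:*_; _:-_; :-_; _:=_)

  sgn-suc : ∀ n → sgn (suc n) ≈ ⊝ sgn n
  sgn-suc n = ≗⇒≈ λ { zero → ℤ.-1*i≡-i (-1ℤ ^ n) ; (suc _) → refl }

  1⊖-cong : ∀ {f g} → f ≈ g → 𝟙 ⊕ ⊝ f ≈ 𝟙 ⊕ ⊝ g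
  1⊖-cong = ⊕-cong (≈-refl {𝟙}) ∘ ⊝-cong

  ∏1-x ∏1+x : Series → ℕ → Series
  ∏1-x x n = ∏< n (λ i → 𝟙 ⊕ ⊝ x ↑ suc i)
  ∏1+x x n = ∏< n (λ i → 𝟙 ⊕ x ↑ suc i)

  -- The partial theta sum over |j| ≤ n of (-1)ʲ x^(j²), with the terms for j and -j merged into the
  -- coefficient 2.
  θ : Series → ℕ → Series
  θ x zero    = 𝟙
  θ x (suc n) = θ x n ⊕ sgn (suc n) ⊗ (const (+ 2) ⊗ x ↑ (suc n ℕ.* suc n))

  module _ (x : Series) where

    -- The factor 1 + x⁰ = 2 accounts for the equal terms ±j of θ.
    lower : ℕ → Series
    lower k = ∏< k (λ i → 𝟙 ⊕ x ↑ i)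

    lower-suc : ∀ n → lower (suc n) ≈ const (+ 2) ⊗ ∏1+x x n
    lower-suc zero    = solve 0 (con 1ℤ :* (con 1ℤ :+ con 1ℤ) := con (+ 2) :* con 1ℤ) ≈-refl
    lower-suc (suc n) = begin
      lower (suc n) ⊗ (𝟙 ⊕ x ↑ suc n)
        ≈⟨ ⊗-cong (lower-suc n) ≈-refl ⟩
      const (+ 2) ⊗ ∏1+x x n ⊗ (𝟙 ⊕ x ↑ suc n)
        ≈⟨ solve 3 (λ a b c → a :* b :* c := a :* (b :* c)) ≈-refl _ _ _ ⟩
      const (+ 2) ⊗ ∏1+x x (suc n) ∎

    upper : ℕ → ℕ → Series
    upper zero    k = 𝟙
    upper (suc d) k = (𝟙 ⊕ ⊝ x ↑ k) ⊗ upper d (suc k)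

    -- `upper` unfolds at its lowest exponent, but the passage from n - 1 to n adds a factor at the
    -- highest one.
    upper-last : ∀ d k → upper (suc d) k ≈ upper d k ⊗ (𝟙 ⊕ ⊝ x ↑ (k ℕ.+ d))
    upper-last zero k rewrite ℕ.+-identityʳ k = solve 1 (λ a → a :* con 1ℤ := con 1ℤ :* a) ≈-refl _
    upper-last (suc d) k rewrite ℕ.+-suc k d = begin
      (𝟙 ⊕ ⊝ x ↑ k) ⊗ upper (suc d) (suc k)
        ≈⟨ ⊗-cong ≈-refl (upper-last d (suc k)) ⟩
      (𝟙 ⊕ ⊝ x ↑ k) ⊗ (upper d (suc k) ⊗ (𝟙 ⊕ ⊝ x ↑ (suc k ℕ.+ d)))
        ≈⟨ solve 3 (λ a b c → a :* (b :* c) := a :* b :* c) ≈-refl _ _ _ ⟩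
      upper (suc d) k ⊗ (𝟙 ⊕ ⊝ x ↑ (suc k ℕ.+ d)) ∎

    upper≈∏1-x : ∀ d → upper d 1 ≈ ∏1-x x d
    upper≈∏1-x zero    = ≈-refl
    upper≈∏1-x (suc d) = ≈-trans (upper-last d 1) (⊗-cong (upper≈∏1-x d) ≈-refl)

    -- The sum over k ≤ j < k + e of (−1)ʲ⁻ᵏ zʲ (1 + x⁰) ⋯ (1 + xʲ⁻¹) (1 − xʲ⁺¹) ⋯ (1 − xᵏ⁺ᵉ⁻¹).
    alternating : Series → ℕ → ℕ → Series
    alternating z zero    k = 𝟘
    alternating z (suc e) k = z ↑ k ⊗ lower k ⊗ upper e (suc k) ⊕ ⊝ alternating z e (suc k)

    -- The step from n − 1 to n = k + e. The summand added on the left is 0 at k = 0 < e, where upper has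
    -- the factor 1 − x⁰.
    alternating-step : ∀ y e k → y ≈ x ↑ (k ℕ.+ e) →
      alternating (x ⊗ y) (suc e) k ⊕ y ↑ k ⊗ lower k ⊗ upper e k ≈
      (𝟙 ⊕ y) ⊗ alternating y e k ⊕ sgn e ⊗ (y ↑ (k ℕ.+ e) ⊗ lower (suc (k ℕ.+ e)))
    alternating-step y zero k y≈ rewrite ℕ.+-identityʳ k = begin
      (x ⊗ y) ↑ k ⊗ lower k ⊗ 𝟙 ⊕ ⊝ 𝟘 ⊕ y ↑ k ⊗ lower k ⊗ 𝟙
        ≈⟨ ⊕-cong (⊕-cong (⊗-cong (⊗-cong (↑-distrib-⊗ x y k) ≈-refl) ≈-refl) ≈-refl) ≈-refl ⟩
      x ↑ k ⊗ y ↑ k ⊗ lower k ⊗ 𝟙 ⊕ ⊝ 𝟘 ⊕ y ↑ k ⊗ lower k ⊗ 𝟙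
        ≈⟨ solve 4 (λ X Y w y → X :* Y :* w :* con 1ℤ :- con 0ℤ :+ Y :* w :* con 1ℤ
             := (con 1ℤ :+ y) :* con 0ℤ :+ con 1ℤ :* (Y :* (w :* (con 1ℤ :+ X))))
             ≈-refl (x ↑ k) (y ↑ k) (lower k) y ⟩
      (𝟙 ⊕ y) ⊗ 𝟘 ⊕ 𝟙 ⊗ (y ↑ k ⊗ lower (suc k)) ∎
    alternating-step y (suc e) k y≈ rewrite ℕ.+-suc k e = begin
      (x ⊗ y) ↑ k ⊗ lower k ⊗ upper (suc e) (suc k) ⊕ ⊝ s′ ⊕ y ↑ k ⊗ lower k ⊗ upper (suc e) k
        -- The hypothesis `y≈` identifies the top factor of `upper (suc e) (suc k)` as 1 - y.
        ≈⟨ ⊕-cong (⊕-cong (⊗-cong (⊗-cong (↑-distrib-⊗ x y k) ≈-refl)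
             (≈-trans (upper-last e (suc k)) (⊗-cong ≈-refl (1⊖-cong (≈-sym y≈))))) ≈-refl) ≈-refl ⟩
      x ↑ k ⊗ y ↑ k ⊗ lower k ⊗ (v ⊗ (𝟙 ⊕ ⊝ y)) ⊕ ⊝ s′ ⊕ y ↑ k ⊗ lower k ⊗ upper (suc e) k
        -- The telescoping: what remains besides (1 + y) times the leading summand is minus the
        -- correction summand at k + 1, so the bracket is the left side of the induction hypothesis.
        ≈⟨ solve 6 (λ X Y w y v s → X :* Y :* w :* (v :* (con 1ℤ :- y)) :- s :+ Y :* w :* ((con 1ℤ :- X) :* v)
             := (con 1ℤ :+ y) :* (Y :* w :* v) :- (s :+ y :* Y :* (w :* (con 1ℤ :+ X)) :* v)) ≈-refl
             (x ↑ k) (y ↑ k) (lower k) y v s′ ⟩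
      (𝟙 ⊕ y) ⊗ (y ↑ k ⊗ lower k ⊗ v) ⊕ ⊝ (s′ ⊕ y ↑ suc k ⊗ lower (suc k) ⊗ v)
        ≈⟨ ⊕-cong (≈-refl {(𝟙 ⊕ y) ⊗ (y ↑ k ⊗ lower k ⊗ v)}) (⊝-cong (alternating-step y e (suc k) y≈)) ⟩
      (𝟙 ⊕ y) ⊗ (y ↑ k ⊗ lower k ⊗ v) ⊕ ⊝ ((𝟙 ⊕ y) ⊗ s ⊕ sgn e ⊗ u)
        ≈⟨ solve 5 (λ y a s e u → (con 1ℤ :+ y) :* a :- ((con 1ℤ :+ y) :* s :+ e :* u)
             := (con 1ℤ :+ y) :* (a :- s) :+ (:- e) :* u) ≈-refl y _ s (sgn e) u ⟩
      (𝟙 ⊕ y) ⊗ alternating y (suc e) k ⊕ ⊝ sgn e ⊗ u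
        ≈⟨ ⊕-cong (≈-refl {(𝟙 ⊕ y) ⊗ alternating y (suc e) k}) (⊗-cong {g = u} (≈-sym (sgn-suc e)) ≈-refl) ⟩
      (𝟙 ⊕ y) ⊗ alternating y (suc e) k ⊕ sgn (suc e) ⊗ u ∎
      where
      v s s′ u : Series
      v  = upper e (suc k)
      s  = alternating y e (suc k)
      s′ = alternating (x ⊗ y) (suc e) (suc k)
      u  = y ↑ suc (k ℕ.+ e) ⊗ lower (suc (suc (k ℕ.+ e)))

    -- By induction: with y = x^(n+1), multiplying case n by 1 + y and adding the two new theta
    -- terms, where x^((n+1)²) = y^(n+1), gives the right side of `alternating-step` at k = 0.
    finite-gauss : ∀ n → ∏1+x x n ⊗ θ x n ≈ alternating (x ↑ suc n) (suc n) 0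
    finite-gauss zero    = solve 0 (con 1ℤ :* con 1ℤ := con 1ℤ :* con 1ℤ :* con 1ℤ :- con 0ℤ) ≈-refl
    finite-gauss (suc n) = begin
      r ⊗ (𝟙 ⊕ y) ⊗ (θ x n ⊕ sgn (suc n) ⊗ (const (+ 2) ⊗ z))
        ≈⟨ solve 5 (λ r y t e z → r :* (con 1ℤ :+ y) :* (t :+ e :* (con (+ 2) :* z))
             := (con 1ℤ :+ y) :* (r :* t) :+ e :* (z :* (con (+ 2) :* (r :* (con 1ℤ :+ y)))))
             ≈-refl r y (θ x n) (sgn (suc n)) z ⟩
      (𝟙 ⊕ y) ⊗ (r ⊗ θ x n) ⊕ sgn (suc n) ⊗ (z ⊗ (const (+ 2) ⊗ ∏1+x x (suc n)))
        ≈⟨ ⊕-cong (⊗-cong ≈-refl (finite-gauss n))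
                  (⊗-cong ≈-refl (⊗-cong (≈-sym (↑-assocʳ x (suc n) (suc n))) (≈-sym (lower-suc (suc n))))) ⟩
      (𝟙 ⊕ y) ⊗ alternating y (suc n) 0 ⊕ sgn (suc n) ⊗ (y ↑ suc n ⊗ lower (suc (suc n)))
        ≈⟨ alternating-step y (suc n) 0 ≈-refl ⟨
      alternating (x ⊗ y) (suc (suc n)) 0 ⊕ y ↑ 0 ⊗ lower 0 ⊗ upper (suc n) 0
        ≈⟨ solve 2 (λ s v → s :+ con 1ℤ :* con 1ℤ :* ((con 1ℤ :- con 1ℤ) :* v) := s) ≈-refl _ (upper n 1) ⟩
      alternating (x ⊗ y) (suc (suc n)) 0 ∎
      where
      r y z : Series
      r = ∏1+x x n
      y = x ↑ suc n
      z = x ↑ (suc n ℕ.* suc n)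

    -- The sum starts at `suc k`, so each of its terms has a factor z; only the term of index 0 can
    -- survive z = 0.
    alternating-zero : ∀ {z} e k → z ≈ 𝟘 → alternating z e (suc k) ≈ 𝟘
    alternating-zero zero    k z≈0 = ≈-refl
    alternating-zero {z} (suc e) k z≈0 = begin
      z ⊗ z ↑ k ⊗ lower (suc k) ⊗ upper e (suc (suc k)) ⊕ ⊝ alternating z e (suc (suc k))
        ≈⟨ ⊕-cong (⊗-cong (⊗-cong (⊗-cong z≈0 ≈-refl) ≈-refl) ≈-refl) (⊝-cong (alternating-zero e (suc k) z≈0)) ⟩
      𝟘 ⊗ z ↑ k ⊗ lower (suc k) ⊗ upper e (suc (suc k)) ⊕ ⊝ 𝟘
        ≈⟨ solve 3 (λ a b c → con 0ℤ :* a :* b :* c :- con 0ℤ := con 0ℤ)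
             ≈-refl (z ↑ k) (lower (suc k)) (upper e (suc (suc k))) ⟩
      𝟘 ∎

    -- Gauss's identity without division. Stopping at `M` loses nothing: x^(j²) = 0 for j > M.
    gauss : ∀ M → x ↑ suc M ≈ 𝟘 → ∏1+x x M ⊗ θ x M ≈ ∏1-x x M
    gauss M nil = begin
      ∏1+x x M ⊗ θ x M
        ≈⟨ finite-gauss M ⟩
      alternating (x ↑ suc M) (suc M) 0
        ≈⟨ ⊕-cong (⊗-cong ≈-refl (upper≈∏1-x M)) (⊝-cong (alternating-zero M 0 nil)) ⟩
      𝟙 ⊗ 𝟙 ⊗ ∏1-x x M ⊕ ⊝ 𝟘
        ≈⟨ solve 1 (λ a → con 1ℤ :* con 1ℤ :* a :- con 0ℤ := a) ≈-refl _ ⟩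
      ∏1-x x M ∎

    -- Every factor past the first M is 1, because its power of x contains x^(M+1) = 0. This
    -- shortens the product of length 2M in `euler-finite` to length M.
    ∏1-x-stable : ∀ M d → x ↑ suc M ≈ 𝟘 → ∏1-x x (d ℕ.+ M) ≈ ∏1-x x M
    ∏1-x-stable M zero    nil = ≈-refl
    ∏1-x-stable M (suc d) nil = begin
      ∏1-x x (d ℕ.+ M) ⊗ (𝟙 ⊕ ⊝ x ↑ suc (d ℕ.+ M))
        ≡⟨ cong (λ m → ∏1-x x (d ℕ.+ M) ⊗ (𝟙 ⊕ ⊝ x ↑ m)) (sym (ℕ.+-suc d M)) ⟩
      ∏1-x x (d ℕ.+ M) ⊗ (𝟙 ⊕ ⊝ x ↑ (d ℕ.+ suc M))
        ≈⟨ ⊗-cong (∏1-x-stable M d nil) (1⊖-cong (≈-trans (↑-homo-⊗ x d (suc M)) (⊗-cong ≈-refl nil))) ⟩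
      ∏1-x x M ⊗ (𝟙 ⊕ ⊝ (x ↑ d ⊗ 𝟘))
        ≈⟨ solve 2 (λ a b → a :* (con 1ℤ :- b :* con 0ℤ) := a) ≈-refl (∏1-x x M) (x ↑ d) ⟩
      ∏1-x x M ∎

  q² : Series
  q² = q ↑ 2

  O⁺ O⁻ E R : ℕ → Series
  O⁺ M = ∏< M (λ i → 𝟙 ⊕ q ↑ suc (i ℕ.* 2))
  O⁻ M = ∏< M (λ i → 𝟙 ⊕ ⊝ q ↑ suc (i ℕ.* 2))
  E = ∏1-x q²
  R = ∏1+x q²

  q²↑ : ∀ k → q² ↑ k ≈ q ↑ (k ℕ.* 2)
  q²↑ k = ≈-trans (↑-assocʳ q 2 k) (≈-reflexive (cong (q ↑_) (ℕ.*-comm 2 k)))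

  -- Euler's identity ∏ (1 − x²ᵏ⁻¹)(1 + xᵏ) = 1 at x = q², multiplied by ∏ (1 − xᵏ).
  euler-finite : ∀ M → O⁺ M ⊗ O⁻ M ⊗ R M ⊗ E M ≈ E (M ℕ.* 2)
  euler-finite zero    = solve 0 (con 1ℤ :* con 1ℤ :* con 1ℤ :* con 1ℤ := con 1ℤ) ≈-refl
  euler-finite (suc M) = begin
    O⁺ M ⊗ (𝟙 ⊕ o) ⊗ (O⁻ M ⊗ (𝟙 ⊕ ⊝ o)) ⊗ (R M ⊗ (𝟙 ⊕ y)) ⊗ (E M ⊗ (𝟙 ⊕ ⊝ y))
      ≈⟨ solve 6 (λ p m r e o y → p :* (con 1ℤ :+ o) :* (m :* (con 1ℤ :- o)) :* (r :* (con 1ℤ :+ y)) :* (e :* (con 1ℤ :- y))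
          := p :* m :* r :* e :* (con 1ℤ :- o :* (o :* con 1ℤ)) :* (con 1ℤ :- y :* (y :* con 1ℤ)))
          ≈-refl (O⁺ M) (O⁻ M) (R M) (E M) o y ⟩
    O⁺ M ⊗ O⁻ M ⊗ R M ⊗ E M ⊗ (𝟙 ⊕ ⊝ o ↑ 2) ⊗ (𝟙 ⊕ ⊝ y ↑ 2)
      -- 1 - o² and 1 - y² are the factors numbered 2M + 1 and 2M + 2 of the product `E`.
      ≈⟨ ⊗-cong (⊗-cong (euler-finite M) (1⊖-cong
            (≈-trans (↑-assocʳ q (suc (M ℕ.* 2)) 2) (≈-sym (q²↑ (suc (M ℕ.* 2)))))))
           (1⊖-cong (↑-assocʳ q² (suc M) 2)) ⟩
    E (suc M ℕ.* 2) ∎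
    where
    o y : Series
    o = q ↑ suc (M ℕ.* 2)
    y = q² ↑ suc M

  -- The last hypothesis replaces division: it exhibits `O⁻ M` and `E M` as units, so multiplying by
  -- its left side allows cancellation.
  pod≈θ⊗a : ∀ M p a → q² ↑ suc M ≈ 𝟘 → p ⊗ E M ≈ O⁺ M → a ⊗ (O⁻ M ⊗ E M ⊗ E M) ≈ 𝟙 → p ≈ θ q² M ⊗ a
  pod≈θ⊗a M p a nil pE aOEE = begin
    p
      ≈⟨ solve 1 (λ p → p := p :* con 1ℤ) ≈-refl p ⟩
    p ⊗ 𝟙
      ≈⟨ ⊗-cong ≈-refl (≈-sym aOEE) ⟩
    p ⊗ (a ⊗ (o ⊗ e ⊗ e))
      ≈⟨ solve 4 (λ p a o e → p :* (a :* (o :* e :* e)) := a :* o :* e :* (p :* e)) ≈-refl p a o e ⟩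
    a ⊗ o ⊗ e ⊗ (p ⊗ e)
      -- Gauss's identity turns one factor `e` into `r ⊗ t`; the other is absorbed with `p` into
      -- `o⁺`.
      ≈⟨ ⊗-cong (⊗-cong ≈-refl (≈-sym (gauss q² M nil))) pE ⟩
    a ⊗ o ⊗ (r ⊗ t) ⊗ o⁺
      ≈⟨ solve 5 (λ a o r t o⁺ → a :* o :* (r :* t) :* o⁺ := t :* a :* (o⁺ :* o :* r)) ≈-refl a o r t o⁺ ⟩
    t ⊗ a ⊗ (o⁺ ⊗ o ⊗ r)
      ≈⟨ ⊗-cong ≈-refl o⁺or≈1 ⟩
    t ⊗ a ⊗ 𝟙
      ≈⟨ solve 1 (λ b → b :* con 1ℤ := b) ≈-refl (t ⊗ a) ⟩
    t ⊗ a ∎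
    where
    o o⁺ e r t : Series
    o  = O⁻ M
    o⁺ = O⁺ M
    e  = E M
    r  = R M
    t  = θ q² M
    o⁺or≈1 : o⁺ ⊗ o ⊗ r ≈ 𝟙
    -- `a ⊗ o ⊗ e` is an inverse of `e`. It cancels `E M` from both sides of `euler-finite`, once
    -- E(2M) is identified with E(M).
    o⁺or≈1 = begin
      o⁺ ⊗ o ⊗ r
        ≈⟨ solve 1 (λ p → p := p :* con 1ℤ) ≈-refl (o⁺ ⊗ o ⊗ r) ⟩
      o⁺ ⊗ o ⊗ r ⊗ 𝟙
        ≈⟨ ⊗-cong ≈-refl (≈-sym aOEE) ⟩
      o⁺ ⊗ o ⊗ r ⊗ (a ⊗ (o ⊗ e ⊗ e))
        ≈⟨ solve 4 (λ w a o e → w :* (a :* (o :* e :* e)) := w :* e :* (a :* o :* e)) ≈-refl (o⁺ ⊗ o ⊗ r) a o e ⟩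
      o⁺ ⊗ o ⊗ r ⊗ e ⊗ (a ⊗ o ⊗ e)
        ≈⟨ ⊗-cong (≈-trans (euler-finite M) (≈-trans (≈-reflexive (cong E (n*2≡n+n M))) (∏1-x-stable q² M M nil))) ≈-refl ⟩
      e ⊗ (a ⊗ o ⊗ e)
        ≈⟨ solve 3 (λ a o e → e :* (a :* o :* e) := a :* (o :* e :* e)) ≈-refl a o e ⟩
      a ⊗ (o ⊗ e ⊗ e)
        ≈⟨ aOEE ⟩
      𝟙 ∎

-- Recurrences for weighted counts of multisets.

sum-map-filter : ∀ {A : Set} {P : Pred A 0ℓ} (P? : Decidable P) (h : A → ℕ) xs →
  sum (map h (filter P? xs)) ≡ sum (map (λ x → if does (P? x) then h x else 0) xs)
sum-map-filter P? h [] = refl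
sum-map-filter P? h (x ∷ xs) with does (P? x)
... | true  = cong (h x ℕ.+_) (sum-map-filter P? h xs)
... | false = sum-map-filter P? h xs

sum-applyUpTo-cong : ∀ {f g : ℕ → ℕ} m → f ≗ g → sum (applyUpTo f m) ≡ sum (applyUpTo g m)
sum-applyUpTo-cong zero    f≗g = refl
sum-applyUpTo-cong (suc m) f≗g = cong₂ ℕ._+_ (f≗g 0) (sum-applyUpTo-cong m (f≗g ∘ suc))

sum-applyUpTo-vanish : ∀ (f : ℕ → ℕ) m d → (∀ k → m ≤ k → f k ≡ 0) →
  sum (applyUpTo f (m ℕ.+ d)) ≡ sum (applyUpTo f m)
sum-applyUpTo-vanish f zero    zero    f≡0 = refl
sum-applyUpTo-vanish f zero    (suc d) f≡0 =
  cong₂ ℕ._+_ (f≡0 0 z≤n) (sum-applyUpTo-vanish (f ∘ suc) zero d (λ k _ → f≡0 (suc k) z≤n))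
sum-applyUpTo-vanish f (suc m) d       f≡0 =
  cong (f 0 ℕ.+_) (sum-applyUpTo-vanish (f ∘ suc) m d (λ k m≤k → f≡0 (suc k) (s≤s m≤k)))

-- The sum of h k over all multiplicities k with k * s ≤ n, in the form used by multisets.
module Multiplicities (s : ℕ) where

  -- Excluded multiplicities become zero terms, so that sums for different `n` can be compared over
  -- a common range.
  term : ℕ → (ℕ → ℕ) → ℕ → ℕ
  term n h k = if does (k ℕ.* s ℕ.≤? n) then h k else 0

  Σ : ℕ → (ℕ → ℕ) → ℕ
  Σ n h = sum (map h (filter (λ k → k ℕ.* s ℕ.≤? n) (upTo (suc n))))

  Σ≡ : ∀ n h → Σ n h ≡ sum (applyUpTo (term n h) (suc n))
  Σ≡ n h = trans (sum-map-filter (λ k → k ℕ.* s ℕ.≤? n) h (upTo (suc n)))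
                 (cong sum (map-upTo (term n h) (suc n)))

  term-> : ∀ {n} h {k} → n < k ℕ.* s → term n h k ≡ 0
  term-> {n} h {k} n<ks rewrite dec-false (k ℕ.* s ℕ.≤? n) (ℕ.<⇒≱ n<ks) = refl

  term-≤ : ∀ {n} h {k} → k ℕ.* s ≤ n → term n h k ≡ h k
  term-≤ {n} h {k} ks≤n rewrite dec-true (k ℕ.* s ℕ.≤? n) ks≤n = refl

  Σ-< : ∀ {n} h → n < s → Σ n h ≡ h 0
  Σ-< {n} h n<s = begin
    Σ n h                                       ≡⟨ Σ≡ n h ⟩
    h 0 ℕ.+ sum (applyUpTo (term n h ∘ suc) n)  ≡⟨ cong (h 0 ℕ.+_) (sum-applyUpTo-vanish (term n h ∘ suc) 0 n
                                                     (λ k _ → term-> h {suc k} (ℕ.<-≤-trans n<s (ℕ.m≤m+n s _)))) ⟩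
    h 0 ℕ.+ 0                                   ≡⟨ ℕ.+-identityʳ (h 0) ⟩
    h 0 ∎
    where open ≡-Reasoning

  -- Multiplicity 0 is split off; for the others, (k + 1)s ≤ s + n means ks ≤ n.
  Σ-+ : 0 < s → ∀ n h → Σ (s ℕ.+ n) h ≡ h 0 ℕ.+ Σ n (h ∘ suc)
  Σ-+ 0<s n h = trans (Σ≡ (s ℕ.+ n) h) (cong (h 0 ℕ.+_) (begin
    sum (applyUpTo (term (s ℕ.+ n) h ∘ suc) (s ℕ.+ n))  ≡⟨ sum-applyUpTo-cong (s ℕ.+ n) shifted ⟩
    sum (applyUpTo (term n (h ∘ suc)) (s ℕ.+ n))        ≡⟨ cong (sum ∘ applyUpTo (term n (h ∘ suc))) s+n≡ ⟩
    sum (applyUpTo (term n (h ∘ suc)) (suc n ℕ.+ ℕ.pred s))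
      -- The range has s + n indices, but `Σ n` has n + 1. The s - 1 surplus terms vanish: n < k
      -- gives n < ks, as s is positive.
      ≡⟨ sum-applyUpTo-vanish (term n (h ∘ suc)) (suc n) (ℕ.pred s)
           (λ k n<k → term-> (h ∘ suc) {k} (ℕ.<-≤-trans n<k (ℕ.m≤m*n k s {{ℕ.>-nonZero 0<s}}))) ⟩
    sum (applyUpTo (term n (h ∘ suc)) (suc n))          ≡⟨ Σ≡ n (h ∘ suc) ⟨
    Σ n (h ∘ suc) ∎))
    where
    open ≡-Reasoning
    s+n≡ : s ℕ.+ n ≡ suc n ℕ.+ ℕ.pred s
    s+n≡ = trans (ℕ.+-comm s n) (trans (cong (n ℕ.+_) (sym (ℕ.suc-pred s {{ℕ.>-nonZero 0<s}}))) (ℕ.+-suc n _))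
    shifted : ∀ k → term (s ℕ.+ n) h (suc k) ≡ term n (h ∘ suc) k
    shifted k with k ℕ.* s ℕ.≤? n
    ... | yes ks≤n = trans (term-≤ h {suc k} (ℕ.+-monoʳ-≤ s ks≤n)) (sym (term-≤ (h ∘ suc) {k} ks≤n))
    ... | no  ks≰n = trans (term-> h {suc k} (ℕ.+-monoʳ-< s (ℕ.≰⇒> ks≰n))) (sym (term-> (h ∘ suc) {k} (ℕ.≰⇒> ks≰n)))

  Σ-cong : ∀ n {h h′} → h ≗ h′ → Σ n h ≡ Σ n h′
  Σ-cong n {h} {h′} h≗h′ = begin
    Σ n h                                ≡⟨ Σ≡ n h ⟩
    sum (applyUpTo (term n h) (suc n))   ≡⟨ sum-applyUpTo-cong (suc n)
                                              (λ k → cong (if does (k ℕ.* s ℕ.≤? n) then_else 0) (h≗h′ k)) ⟩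
    sum (applyUpTo (term n h′) (suc n))  ≡⟨ Σ≡ n h′ ⟨
    Σ n h′ ∎
    where open ≡-Reasoning

-- An additive weight `μ` serves both counts: `length` for cubic partitions, and the number of lists
-- with distinct odd parts for pod.
module Count {A : Set} (size : A → ℕ) (μ : List (List A) → ℕ)
  (μ-[] : μ [] ≡ 0) (μ-++ : ∀ xs ys → μ (xs ++ ys) ≡ μ xs ℕ.+ μ ys) where

  count : List A → ℕ → ℕ
  count ps n = μ (multisets size ps n)

  μ-concatMap : ∀ {B : Set} (f : B → List (List A)) xs → μ (concatMap f xs) ≡ sum (map (μ ∘ f) xs)
  μ-concatMap f []       = μ-[]
  μ-concatMap f (x ∷ xs) = trans (μ-++ (f x) (concatMap f xs)) (cong (μ (f x) ℕ.+_) (μ-concatMap f xs))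

  module _ (p : A) (ps : List A) where
    open Multiplicities (size p)

    extensions : ℕ → ℕ → ℕ
    extensions n k = μ (Multisets.extend size p ps n k)

    extensions-0 : ∀ n → extensions n 0 ≡ count ps n
    extensions-0 n = cong μ (map-id (multisets size ps n))

    count-∷ : ∀ n → count (p ∷ ps) n ≡ Σ n (extensions n)
    count-∷ n = μ-concatMap (Multisets.extend size p ps n) (filter (λ k → k ℕ.* size p ℕ.≤? n) (upTo (suc n)))

    count-< : ∀ {n} → n < size p → count (p ∷ ps) n ≡ count ps n
    count-< {n} n<s = trans (count-∷ n) (trans (Σ-< (extensions n) n<s) (extensions-0 n))

    extensions-suc : ∀ n k → extensions (size p ℕ.+ n) (suc k) ≡
      μ (map (replicate (suc k) p ++_) (multisets size ps (n ∸ k ℕ.* size p)))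
    extensions-suc n k = cong (μ ∘ map (replicate (suc k) p ++_) ∘ multisets size ps)
      (ℕ.[m+n]∸[m+o]≡n∸o (size p) n (k ℕ.* size p))

    module _ (0<s : 0 < size p) where

      count-+ : ∀ n → count (p ∷ ps) (size p ℕ.+ n) ≡
        count ps (size p ℕ.+ n) ℕ.+ Σ n (λ k → μ (map (replicate (suc k) p ++_) (multisets size ps (n ∸ k ℕ.* size p))))
      count-+ n = trans (count-∷ (size p ℕ.+ n)) (trans (Σ-+ 0<s n (extensions (size p ℕ.+ n)))
        (cong₂ ℕ._+_ (extensions-0 (size p ℕ.+ n)) (Σ-cong n (extensions-suc n))))

      -- Removing one copy of `p` from the multisets containing it leaves all multisets over
      -- `p ∷ ps`. This is the recurrence of the factor 1/(1 - qˢ) with s = `size p`.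
      count-repeatable : (∀ k m → μ (map (replicate k p ++_) (multisets size ps m)) ≡ count ps m) →
        ∀ n → count (p ∷ ps) (size p ℕ.+ n) ≡ count ps (size p ℕ.+ n) ℕ.+ count (p ∷ ps) n
      count-repeatable rep n = trans (count-+ n) (cong (count ps (size p ℕ.+ n) ℕ.+_)
        (trans (Σ-cong n (λ k → trans (rep (suc k) _) (sym (rep k _)))) (sym (count-∷ n))))

      -- Two or more copies of `p` have weight 0, which leaves the recurrence of the factor 1 + qˢ.
      count-distinct : (∀ m → μ (map (p ∷_) (multisets size ps m)) ≡ count ps m) →
        (∀ k m → μ (map (replicate (suc (suc k)) p ++_) (multisets size ps m)) ≡ 0) →
        ∀ n → count (p ∷ ps) (size p ℕ.+ n) ≡ count ps (size p ℕ.+ n) ℕ.+ count ps n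
      count-distinct one many n = trans (count-+ n) (cong (count ps (size p ℕ.+ n) ℕ.+_) (begin
        Σ n g                                      ≡⟨ Σ≡ n g ⟩
        g 0 ℕ.+ sum (applyUpTo (term n g ∘ suc) n)
          -- `g k` belongs to k + 1 copies of `p`: `g 0` is the single copy, and all later terms
          -- have at least two.
          ≡⟨ cong₂ ℕ._+_ (one n) (sum-applyUpTo-vanish (term n g ∘ suc) 0 n (λ k _ → vanish k)) ⟩
        count ps n ℕ.+ 0                           ≡⟨ ℕ.+-identityʳ _ ⟩
        count ps n ∎))
        where
        open ≡-Reasoning
        g : ℕ → ℕ
        g k = μ (map (replicate (suc k) p ++_) (multisets size ps (n ∸ k ℕ.* size p)))
        vanish : ∀ k → term n g (suc k) ≡ 0
        vanish k with does (suc k ℕ.* size p ℕ.≤? n)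
        ... | true  = many k _
        ... | false = refl

-- Recurrences for pod and cubic partitions.

module Cubic = Count {ColouredPart} proj₁ length refl (λ xs ys → length-++ xs)

module _ {A : Set} {P : Pred A 0ℓ} (P? : Decidable P) where

  private
    number : List A → ℕ
    number = length ∘ filter P?

  length-filter-++ : ∀ xs ys → number (xs ++ ys) ≡ number xs ℕ.+ number ys
  length-filter-++ xs ys = trans (cong length (filter-++ P? xs ys)) (length-++ (filter P? xs))

  length-filter-map-⇔ : ∀ (f : A → A) {xs} → All (λ x → P (f x) ⇔ P x) xs → number (map f xs) ≡ number xs
  length-filter-map-⇔ f [] = refl
  length-filter-map-⇔ f {x ∷ xs} (e ∷ es) with P? (f x) | P? x
  ... | yes _  | yes _  = cong suc (length-filter-map-⇔ f es)
  ... | no  _  | no  _  = length-filter-map-⇔ f es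
  ... | yes pf | no  ¬p = ⊥-elim (¬p (Equivalence.to e pf))
  ... | no ¬pf | yes p  = ⊥-elim (¬pf (Equivalence.from e p))

  length-filter-none : ∀ {xs} → All (¬_ ∘ P) xs → number xs ≡ 0
  length-filter-none = cong length ∘ filter-none P?

module Pod = Count {ℕ} id (length ∘ filter oddPartsDistinct?) refl (length-filter-++ oddPartsDistinct?)

odd? : Decidable (λ k → ¬ (2 ∣ k))
odd? k = ¬? (2 ∣? k)

filter-odd-replicate-even : ∀ {p} → 2 ∣ p → ∀ k ys → filter odd? (replicate k p ++ ys) ≡ filter odd? ys
filter-odd-replicate-even even zero    ys = refl
filter-odd-replicate-even even (suc k) ys =
  trans (filter-reject odd? (λ odd → odd even)) (filter-odd-replicate-even even k ys)

-- Members of these multisets are at most n. Hence prefixing one copy of an odd part `suc n` creates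
-- no repetition.
∉-multisets-parts : ∀ n m → All (suc n ∉_) (multisets id (parts n) m)
∉-multisets-parts n m = All.tabulate λ ys∈ n∈ → ℕ.1+n≰n (proj₂ (parts-sound n
  (All.lookup (proj₁ (proj₂ (Multisets.multisets-sound id {ℕ._≥_} ℕ.≤-refl (λ p r → ℕ.≤-antisym r p)
     (AllPairs.map ℕ.<⇒≤ (parts-decreasing n)) ys∈))) n∈)))

-- Copies of an even part are invisible to the filter for odd parts, so they do not affect
-- distinctness.
pod-even : ∀ n → 2 ∣ suc n → ∀ m → Pod.count (parts (suc n)) (suc n ℕ.+ m) ≡
           Pod.count (parts n) (suc n ℕ.+ m) ℕ.+ Pod.count (parts (suc n)) m
pod-even n even = Pod.count-repeatable (suc n) (parts n) z<s λ k m →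
  length-filter-map-⇔ oddPartsDistinct? (replicate k (suc n) ++_) (All.universal (λ ys →
    mk⇔ (subst Unique (filter-odd-replicate-even even k ys))
        (subst Unique (sym (filter-odd-replicate-even even k ys)))) (multisets id (parts n) m))

pod-odd : ∀ n → ¬ (2 ∣ suc n) → ∀ m → Pod.count (parts (suc n)) (suc n ℕ.+ m) ≡
          Pod.count (parts n) (suc n ℕ.+ m) ℕ.+ Pod.count (parts n) m
pod-odd n odd = Pod.count-distinct (suc n) (parts n) z<s
  (λ m → length-filter-map-⇔ oddPartsDistinct? (suc n ∷_) (All.map one (∉-multisets-parts n m)))
  (λ k m → length-filter-none oddPartsDistinct? (All.map⁺ (All.universal (many k) (multisets id (parts n) m))))
  where
  accept : ∀ xs → filter odd? (suc n ∷ xs) ≡ suc n ∷ filter odd? xs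
  accept xs = filter-accept odd? odd
  one : ∀ {ys} → suc n ∉ ys → OddPartsDistinct (suc n ∷ ys) ⇔ OddPartsDistinct ys
  one {ys} n∉ = mk⇔ (λ u → AllPairs.tail (subst Unique (accept ys) u))
    (λ u → subst Unique (sym (accept ys))
       (All.¬Any⇒All¬ _ (λ n∈ → n∉ (proj₁ (∈-filter⁻ odd? {xs = ys} n∈))) ∷ u))
  many : ∀ k ys → ¬ OddPartsDistinct (replicate (suc (suc k)) (suc n) ++ ys)
  many k ys u with subst Unique (trans (accept (suc n ∷ replicate k (suc n) ++ ys)) (cong (suc n ∷_) (accept _))) u
  ... | (n≢n ∷ _) ∷ _ = n≢n refl

cubic-∷ : ∀ p ps → 0 < proj₁ p → ∀ m →
          Cubic.count (p ∷ ps) (proj₁ p ℕ.+ m) ≡ Cubic.count ps (proj₁ p ℕ.+ m) ℕ.+ Cubic.count (p ∷ ps) m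
cubic-∷ p ps 0<p = Cubic.count-repeatable p ps 0<p (λ k m → length-map (replicate k p ++_) (multisets proj₁ ps m))

cubic-skip : ∀ {m} ps qs → All (λ p → m < proj₁ p) ps → Cubic.count (ps ++ qs) m ≡ Cubic.count qs m
cubic-skip []       qs []          = refl
cubic-skip (p ∷ ps) qs (m<p ∷ m<ps) = trans (Cubic.count-< p (ps ++ qs) m<p) (cubic-skip ps qs m<ps)

-- Parts above m cannot occur in total m. The generating function uses one list of parts for all its
-- coefficients, whereas in `a` the list varies with the total.
cubic-stable : ∀ d m → Cubic.count (colouredParts (d ℕ.+ m)) m ≡ Cubic.count (colouredParts m) m
cubic-stable zero    m = refl
cubic-stable (suc d) m = trans
  (cubic-skip (coloursOf (suc (d ℕ.+ m))) (colouredParts (d ℕ.+ m))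
     (All.tabulate λ x∈ → ℕ.≤-trans (s≤s (ℕ.m≤n+m m d)) (ℕ.≤-reflexive (sym (proj₁ (coloursOf-sound _ x∈))))))
  (cubic-stable d m)

pod-stable : ∀ d m → Pod.count (parts (d ℕ.+ m)) m ≡ Pod.count (parts m) m
pod-stable zero    m = refl
pod-stable (suc d) m = trans (Pod.count-< (suc (d ℕ.+ m)) (parts (d ℕ.+ m)) (s≤s (ℕ.m≤n+m m d))) (pod-stable d m)

coloursOf-even : ∀ {k} → 2 ∣ k → coloursOf k ≡ (k , suc zero) ∷ (k , zero) ∷ []
coloursOf-even {k} even with 2 ∣? k
... | yes _  = refl
... | no odd = ⊥-elim (odd even)

coloursOf-odd : ∀ {k} → ¬ (2 ∣ k) → coloursOf k ≡ (k , zero) ∷ []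
coloursOf-odd {k} odd with 2 ∣? k
... | yes even = ⊥-elim (odd even)
... | no _     = refl

2∤1+k*2 : ∀ k → ¬ (2 ∣ suc (k ℕ.* 2))
2∤1+k*2 k 2∣ with ∣1⇒≡1 (∣m+n∣m⇒∣n (subst (2 ∣_) (ℕ.+-comm 1 (k ℕ.* 2)) 2∣) (divides k refl))
... | ()

-- Product formulas for the generating functions.

series : (ℕ → ℕ) → Series
series f n = + f n

split-at : ∀ s n → n < s ⊎ (∃[ m ] n ≡ s ℕ.+ m)
split-at s n with n ℕ.<? s
... | yes n<s = inj₁ n<s
... | no  n≮s = inj₂ (n ∸ s , sym (ℕ.m+[n∸m]≡n (ℕ.≮⇒≥ n≮s)))

module GeneratingFunctions (N : ℕ) where
  open Truncated N
  open Gauss N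
  open Solver using (solve; con; _:+_; _:*_; _:-_; :-_; _:=_)
  open Relation.Binary.Reasoning.Setoid setoid

  q⊗-suc : ∀ f n → (q ⊗ f) (suc n) ≡ f n
  q⊗-suc f n = trans (ℤ.+-identityˡ _) (⊗-identityˡ f n)

  q↑-< : ∀ s f {n} → n < s → (q ↑ s ⊗ f) n ≡ 0ℤ
  q↑-< (suc s) f {zero}  _         = refl
  q↑-< (suc s) f {suc n} (s≤s n<s) = trans (⊗-assoc q (q ↑ s) f (suc n)) (trans (q⊗-suc (q ↑ s ⊗ f) n) (q↑-< s f n<s))

  q↑-+ : ∀ s f n → (q ↑ s ⊗ f) (s ℕ.+ n) ≡ f n
  q↑-+ zero    f n = ⊗-identityˡ f n
  q↑-+ (suc s) f n = trans (⊗-assoc q (q ↑ s) f (suc (s ℕ.+ n))) (trans (q⊗-suc (q ↑ s ⊗ f) (s ℕ.+ n)) (q↑-+ s f n))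

  -- Multiplication by qˢ shifts coefficients by s, so the ranges n < s and s + n combine into one
  -- equation. Taking `h` to be `f` or `g` gives the factor 1 + qˢ or 1/(1 - qˢ).
  shift-recurrence : ∀ {s} f g h → (∀ {n} → n < s → g n ≡ f n) → (∀ n → g (s ℕ.+ n) ≡ f (s ℕ.+ n) ℕ.+ h n) →
                     series g ≗ series f ⊕ q ↑ s ⊗ series h
  shift-recurrence {s} f g h lo hi n with split-at s n
  ... | inj₁ n<s        = trans (cong +_ (lo n<s)) (sym (trans
    (cong (λ i → + f n ℤ.+ i) (q↑-< s (series h) n<s)) (ℤ.+-identityʳ _)))
  ... | inj₂ (m , refl) = trans (cong +_ (hi m)) (trans (ℤ.pos-+ (f n) (h m))
    (cong (λ i → + f n ℤ.+ i) (sym (q↑-+ s (series h) m))))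

  ⊗[1+q↑] : ∀ {s} f g → (∀ {n} → n < s → g n ≡ f n) → (∀ n → g (s ℕ.+ n) ≡ f (s ℕ.+ n) ℕ.+ f n) →
            series g ≈ series f ⊗ (𝟙 ⊕ q ↑ s)
  ⊗[1+q↑] {s} f g lo hi = begin
    series g
      ≈⟨ ≗⇒≈ (shift-recurrence f g f lo hi) ⟩
    series f ⊕ q ↑ s ⊗ series f
      ≈⟨ solve 2 (λ f x → f :+ x :* f := f :* (con 1ℤ :+ x)) ≈-refl (series f) (q ↑ s) ⟩
    series f ⊗ (𝟙 ⊕ q ↑ s) ∎

  ⊗[1-q↑] : ∀ {s} f g → (∀ {n} → n < s → g n ≡ f n) → (∀ n → g (s ℕ.+ n) ≡ f (s ℕ.+ n) ℕ.+ g n) →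
            series g ⊗ (𝟙 ⊕ ⊝ q ↑ s) ≈ series f
  ⊗[1-q↑] {s} f g lo hi = begin
    series g ⊗ (𝟙 ⊕ ⊝ q ↑ s)
      ≈⟨ solve 2 (λ f x → f :* (con 1ℤ :- x) := f :- x :* f) ≈-refl (series g) (q ↑ s) ⟩
    series g ⊕ ⊝ (q ↑ s ⊗ series g)
      ≈⟨ ⊕-cong (≗⇒≈ (shift-recurrence f g g lo hi)) (≈-refl {⊝ (q ↑ s ⊗ series g)}) ⟩
    series f ⊕ q ↑ s ⊗ series g ⊕ ⊝ (q ↑ s ⊗ series g)
      ≈⟨ solve 2 (λ f x → f :+ x :- x := f) ≈-refl (series f) (q ↑ s ⊗ series g) ⟩
    series f ∎

  podGF cubicGF : ℕ → Series
  podGF   n = series (Pod.count (parts n))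
  cubicGF n = series (Cubic.count (colouredParts n))

  even-factor : ∀ M → 𝟙 ⊕ ⊝ q² ↑ suc M ≈ 𝟙 ⊕ ⊝ q ↑ (suc M ℕ.* 2)
  even-factor M = 1⊖-cong (q²↑ (suc M))

  -- Each induction step admits two parts: 2M + 1 contributes 1 + q^(2M+1), and 2M + 2 contributes
  -- 1/(1 - q^(2M+2)).
  podGF⊗E : ∀ M → podGF (M ℕ.* 2) ⊗ E M ≈ O⁺ M
  podGF⊗E zero    = ≈-trans (⊗-cong (≗⇒≈ (λ { zero → refl ; (suc n) → refl })) ≈-refl)
    (solve 0 (con 1ℤ :* con 1ℤ := con 1ℤ) ≈-refl)
  podGF⊗E (suc M) = begin
    podGF (suc M ℕ.* 2) ⊗ (E M ⊗ (𝟙 ⊕ ⊝ q² ↑ suc M))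
      ≈⟨ ⊗-cong (≈-refl {podGF (suc M ℕ.* 2)}) (⊗-cong (≈-refl {E M}) (even-factor M)) ⟩
    podGF (suc M ℕ.* 2) ⊗ (E M ⊗ (𝟙 ⊕ ⊝ q ↑ (suc M ℕ.* 2)))
      ≈⟨ solve 3 (λ p e y → p :* (e :* y) := p :* y :* e)
           ≈-refl (podGF (suc M ℕ.* 2)) (E M) (𝟙 ⊕ ⊝ q ↑ (suc M ℕ.* 2)) ⟩
    podGF (suc M ℕ.* 2) ⊗ (𝟙 ⊕ ⊝ q ↑ (suc M ℕ.* 2)) ⊗ E M
      ≈⟨ ⊗-cong (⊗[1-q↑] (Pod.count (parts (suc (M ℕ.* 2)))) (Pod.count (parts (suc M ℕ.* 2)))
           (Pod.count-< (suc M ℕ.* 2) (parts (suc (M ℕ.* 2)))) (pod-even (suc (M ℕ.* 2)) (divides (suc M) refl))) ≈-refl ⟩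
    podGF (suc (M ℕ.* 2)) ⊗ E M
      ≈⟨ ⊗-cong (⊗[1+q↑] (Pod.count (parts (M ℕ.* 2))) (Pod.count (parts (suc (M ℕ.* 2))))
           (Pod.count-< (suc (M ℕ.* 2)) (parts (M ℕ.* 2))) (pod-odd (M ℕ.* 2) (2∤1+k*2 M))) ≈-refl ⟩
    podGF (M ℕ.* 2) ⊗ (𝟙 ⊕ q ↑ suc (M ℕ.* 2)) ⊗ E M
      ≈⟨ solve 3 (λ p e y → p :* y :* e := p :* e :* y) ≈-refl (podGF (M ℕ.* 2)) (E M) (𝟙 ⊕ q ↑ suc (M ℕ.* 2)) ⟩
    podGF (M ℕ.* 2) ⊗ E M ⊗ (𝟙 ⊕ q ↑ suc (M ℕ.* 2))
      ≈⟨ ⊗-cong (podGF⊗E M) ≈-refl ⟩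
    O⁺ (suc M) ∎

  cubic-factor : ∀ p ps → 0 < proj₁ p →
    series (Cubic.count (p ∷ ps)) ⊗ (𝟙 ⊕ ⊝ q ↑ proj₁ p) ≈ series (Cubic.count ps)
  cubic-factor p ps 0<p = ⊗[1-q↑] (Cubic.count ps) (Cubic.count (p ∷ ps)) (Cubic.count-< p ps) (cubic-∷ p ps 0<p)

  colouredParts-step : ∀ M → colouredParts (suc M ℕ.* 2) ≡
    (suc M ℕ.* 2 , suc zero) ∷ (suc M ℕ.* 2 , zero) ∷ (suc (M ℕ.* 2) , zero) ∷ colouredParts (M ℕ.* 2)
  colouredParts-step M = cong₂ (λ xs ys → xs ++ ys ++ colouredParts (M ℕ.* 2))
    (coloursOf-even (divides (suc M) refl)) (coloursOf-odd (2∤1+k*2 M))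

  -- Three coloured parts are new, the even one in two colours and the odd one in one; each is
  -- cancelled by its own factor, in list order.
  cubicGF-step : ∀ M →
    cubicGF (suc M ℕ.* 2) ⊗ (𝟙 ⊕ ⊝ q ↑ (suc M ℕ.* 2)) ⊗ (𝟙 ⊕ ⊝ q ↑ (suc M ℕ.* 2)) ⊗ (𝟙 ⊕ ⊝ q ↑ suc (M ℕ.* 2))
    ≈ cubicGF (M ℕ.* 2)
  cubicGF-step M rewrite colouredParts-step M =
    ≈-trans (⊗-cong (≈-trans (⊗-cong (cubic-factor (suc M ℕ.* 2 , suc zero) (x₀ ∷ x₁ ∷ xs) z<s) ≈-refl)
                             (cubic-factor x₀ (x₁ ∷ xs) z<s)) ≈-refl)
            (cubic-factor x₁ xs z<s)
    where
    x₀ x₁ : ColouredPart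
    x₀ = suc M ℕ.* 2 , zero
    x₁ = suc (M ℕ.* 2) , zero
    xs : List ColouredPart
    xs = colouredParts (M ℕ.* 2)

  cubicGF⊗O⁻EE : ∀ M → cubicGF (M ℕ.* 2) ⊗ (O⁻ M ⊗ E M ⊗ E M) ≈ 𝟙
  cubicGF⊗O⁻EE zero    = ≈-trans (⊗-cong (≗⇒≈ (λ { zero → refl ; (suc n) → refl })) ≈-refl)
    (solve 0 (con 1ℤ :* (con 1ℤ :* con 1ℤ :* con 1ℤ) := con 1ℤ) ≈-refl)
  cubicGF⊗O⁻EE (suc M) = begin
    c ⊗ (O⁻ M ⊗ z ⊗ (E M ⊗ (𝟙 ⊕ ⊝ q² ↑ suc M)) ⊗ (E M ⊗ (𝟙 ⊕ ⊝ q² ↑ suc M)))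
      ≈⟨ ⊗-cong (≈-refl {c}) (⊗-cong (⊗-cong (≈-refl {O⁻ M ⊗ z}) (⊗-cong (≈-refl {E M}) (even-factor M)))
                                     (⊗-cong (≈-refl {E M}) (even-factor M))) ⟩
    c ⊗ (O⁻ M ⊗ z ⊗ (E M ⊗ y) ⊗ (E M ⊗ y))
      ≈⟨ solve 5 (λ c o z e y → c :* (o :* z :* (e :* y) :* (e :* y)) := c :* y :* y :* z :* (o :* e :* e))
           ≈-refl c (O⁻ M) z (E M) y ⟩
    c ⊗ y ⊗ y ⊗ z ⊗ (O⁻ M ⊗ E M ⊗ E M)
      ≈⟨ ⊗-cong (cubicGF-step M) ≈-refl ⟩
    cubicGF (M ℕ.* 2) ⊗ (O⁻ M ⊗ E M ⊗ E M)
      ≈⟨ cubicGF⊗O⁻EE M ⟩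
    𝟙 ∎
    where
    c y z : Series
    c = cubicGF (suc M ℕ.* 2)
    y = 𝟙 ⊕ ⊝ q ↑ (suc M ℕ.* 2)
    z = 𝟙 ⊕ ⊝ q ↑ suc (M ℕ.* 2)

  q²↑-nilpotent : ∀ {M} → N ≤ M → q² ↑ suc M ≈ 𝟘
  q²↑-nilpotent {M} N≤M = begin
    q² ↑ suc M                  ≈⟨ q²↑ (suc M) ⟩
    q ↑ (suc M ℕ.* 2)           ≈⟨ solve 1 (λ x → x := x :* con 1ℤ) ≈-refl (q ↑ (suc M ℕ.* 2)) ⟩
    q ↑ (suc M ℕ.* 2) ⊗ 𝟙       ≈⟨ mk≈ (λ {i} i≤N → trans
         (q↑-< (suc M ℕ.* 2) 𝟙 (ℕ.<-≤-trans (s≤s (ℕ.≤-trans i≤N N≤M)) (ℕ.m≤m*n (suc M) 2))) (sym (const-0 i))) ⟩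
    𝟘 ∎
    where
    const-0 : ∀ i → 𝟘 i ≡ 0ℤ
    const-0 zero    = refl
    const-0 (suc i) = refl

-- Extraction of coefficients and the sum over j.

summand : ℕ → ℤ → ℤ
summand n j = -1ℤ ^ ∣ j ∣ * + a (+ n - + 2 * j ^ 2)

j²≡∣j∣² : ∀ j → j ^ 2 ≡ + (∣ j ∣ ℕ.* ∣ j ∣)
j²≡∣j∣² j = trans (cong (j *_) (ℤ.*-identityʳ j)) (square j)
  where
  square : ∀ j → j * j ≡ + (∣ j ∣ ℕ.* ∣ j ∣)
  square (+ n)    = sym (ℤ.pos-* n n)
  square -[1+ n ] = refl

argument : ∀ n j → + n - + 2 * j ^ 2 ≡ n ℤ.⊖ (∣ j ∣ ℕ.* ∣ j ∣) ℕ.* 2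
argument n j = trans (cong (λ i → + n - i) (begin
    + 2 * j ^ 2                     ≡⟨ cong (+ 2 *_) (j²≡∣j∣² j) ⟩
    + 2 * + (∣ j ∣ ℕ.* ∣ j ∣)       ≡⟨ ℤ.pos-* 2 (∣ j ∣ ℕ.* ∣ j ∣) ⟨
    + (2 ℕ.* (∣ j ∣ ℕ.* ∣ j ∣))     ≡⟨ cong +_ (ℕ.*-comm 2 (∣ j ∣ ℕ.* ∣ j ∣)) ⟩
    + ((∣ j ∣ ℕ.* ∣ j ∣) ℕ.* 2) ∎)) (ℤ.m-n≡m⊖n n ((∣ j ∣ ℕ.* ∣ j ∣) ℕ.* 2))
  where open ≡-Reasoning

a-⊖-< : ∀ {n s} → n < s → a (n ℤ.⊖ s) ≡ 0
-- Positivity of `s ∸ n` excludes 0, so the argument has the form `-[1+ d ]`, where `a` is 0 by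
-- convention.
a-⊖-< {n} {s} n<s with s ∸ n | ℤ.⊖-< n<s | ℕ.m<n⇒0<n∸m n<s
... | suc d | eq | _ rewrite eq = refl

-- If |j| > n then 2j² ≥ |j| > n, and the argument of `a` is negative.
summand-vanish : ∀ n j → n < ∣ j ∣ → summand n j ≡ 0ℤ
summand-vanish n j n<∣j∣ = begin
  -1ℤ ^ ∣ j ∣ * + a (+ n - + 2 * j ^ 2)
    ≡⟨ cong (λ i → -1ℤ ^ ∣ j ∣ * + a i) (argument n j) ⟩
  -1ℤ ^ ∣ j ∣ * + a (n ℤ.⊖ ∣ j ∣ ℕ.* ∣ j ∣ ℕ.* 2)
    ≡⟨ cong (λ k → -1ℤ ^ ∣ j ∣ * + k) (a-⊖-< {n} {∣ j ∣ ℕ.* ∣ j ∣ ℕ.* 2} (bound ∣ j ∣ n<∣j∣)) ⟩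
  -1ℤ ^ ∣ j ∣ * 0ℤ
    ≡⟨ ℤ.*-zeroʳ (-1ℤ ^ ∣ j ∣) ⟩
  0ℤ ∎
  where
  open ≡-Reasoning
  bound : ∀ k → n < k → n < (k ℕ.* k) ℕ.* 2
  bound k@(suc _) n<k = ℕ.<-≤-trans n<k (ℕ.≤-trans (ℕ.m≤m*n k k) (ℕ.m≤m*n (k ℕ.* k) 2))

module _ (n : ℕ) where
  open Truncated n
  open Gauss n
  open GeneratingFunctions n

  cubic-coeff : ∀ {m} → m ≤ n → cubicGF (n ℕ.* 2) m ≡ + a (+ m)
  cubic-coeff {m} m≤n = cong +_ (trans (cong (λ k → Cubic.count (colouredParts k) m) n*2≡)
    (cubic-stable (n ∸ m ℕ.+ n) m))
    where
    n*2≡ : n ℕ.* 2 ≡ n ∸ m ℕ.+ n ℕ.+ m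
    n*2≡ = trans (n*2≡n+n n) (begin
      n ℕ.+ n                 ≡⟨ cong (ℕ._+ n) (ℕ.m∸n+n≡m m≤n) ⟨
      n ∸ m ℕ.+ m ℕ.+ n       ≡⟨ ℕ.+-assoc (n ∸ m) m n ⟩
      n ∸ m ℕ.+ (m ℕ.+ n)     ≡⟨ cong (n ∸ m ℕ.+_) (ℕ.+-comm m n) ⟩
      n ∸ m ℕ.+ (n ℕ.+ m)     ≡⟨ ℕ.+-assoc (n ∸ m) n m ⟨
      n ∸ m ℕ.+ n ℕ.+ m ∎)
      where open ≡-Reasoning

  pod-coeff : podGF (n ℕ.* 2) n ≡ + pod n
  pod-coeff = cong +_ (trans (cong (λ k → Pod.count (parts k) n) (n*2≡n+n n)) (pod-stable n n))

  -- For n < s both sides vanish, the left by the shift and the right by the convention for negative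
  -- arguments. Otherwise n - s is at most n, where `cubic-coeff` applies.
  q↑⊗cubic : ∀ s → (q ↑ s ⊗ cubicGF (n ℕ.* 2)) n ≡ + a (n ℤ.⊖ s)
  q↑⊗cubic s with split-at s n
  ... | inj₁ n<s        = trans (q↑-< s (cubicGF (n ℕ.* 2)) n<s) (cong +_ (sym (a-⊖-< n<s)))
  ... | inj₂ (m , n≡) = begin
    (q ↑ s ⊗ c) n          ≡⟨ cong (q ↑ s ⊗ c) n≡ ⟩
    (q ↑ s ⊗ c) (s ℕ.+ m)  ≡⟨ q↑-+ s c m ⟩
    c m                    ≡⟨ cubic-coeff (ℕ.≤-trans (ℕ.m≤n+m m s) (ℕ.≤-reflexive (sym n≡))) ⟩
    + a (+ m)              ≡⟨ cong (+_ ∘ a) (begin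
         n ℤ.⊖ s              ≡⟨ cong (ℤ._⊖ s) n≡ ⟩
         (s ℕ.+ m) ℤ.⊖ s      ≡⟨ ℤ.⊖-≥ (ℕ.m≤m+n s m) ⟩
         + (s ℕ.+ m ∸ s)      ≡⟨ cong +_ (ℕ.m+n∸m≡n s m) ⟩
         + m ∎) ⟨
    + a (n ℤ.⊖ s) ∎
    where
    open ≡-Reasoning
    c = cubicGF (n ℕ.* 2)

  summand≡ : ∀ j → summand n j ≡ -1ℤ ^ ∣ j ∣ * (q² ↑ (∣ j ∣ ℕ.* ∣ j ∣) ⊗ cubicGF (n ℕ.* 2)) n
  summand≡ j = cong (-1ℤ ^ ∣ j ∣ *_) (begin
    + a (+ n - + 2 * j ^ 2)
      ≡⟨ cong (+_ ∘ a) (argument n j) ⟩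
    + a (n ℤ.⊖ (∣ j ∣ ℕ.* ∣ j ∣) ℕ.* 2)
      ≡⟨ q↑⊗cubic ((∣ j ∣ ℕ.* ∣ j ∣) ℕ.* 2) ⟨
    (q ↑ ((∣ j ∣ ℕ.* ∣ j ∣) ℕ.* 2) ⊗ c) n
      ≡⟨ coeff (⊗-cong (q²↑ (∣ j ∣ ℕ.* ∣ j ∣)) (≈-refl {c})) ℕ.≤-refl ⟨
    (q² ↑ (∣ j ∣ ℕ.* ∣ j ∣) ⊗ c) n ∎)
    where
    open ≡-Reasoning
    c = cubicGF (n ℕ.* 2)

  θ⊗cubic : ∀ M → (θ q² M ⊗ cubicGF (n ℕ.* 2)) n ≡ sumUpTo M (summand n)
  θ⊗cubic zero = sym (trans (summand≡ 0ℤ) (ℤ.*-identityˡ _))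
  θ⊗cubic (suc M) = begin
    ((θ q² M ⊕ sgn (suc M) ⊗ (const (+ 2) ⊗ z)) ⊗ c) n
      ≡⟨ coeff (solve 5 (λ t e k z c → (t :+ e :* (k :* z)) :* c := t :* c :+ e :* (k :* (z :* c))) ≈-refl
           (θ q² M) (sgn (suc M)) (const (+ 2)) z c) ℕ.≤-refl ⟩
    (θ q² M ⊗ c) n ℤ.+ (sgn (suc M) ⊗ (const (+ 2) ⊗ (z ⊗ c))) n
      ≡⟨ cong₂ ℤ._+_ (θ⊗cubic M) (begin
           (sgn (suc M) ⊗ (const (+ 2) ⊗ (z ⊗ c))) n     ≡⟨ const-⊗ (-1ℤ ^ suc M) _ n ⟩
           -1ℤ ^ suc M * (const (+ 2) ⊗ (z ⊗ c)) n       ≡⟨ cong (-1ℤ ^ suc M *_) (const-⊗ (+ 2) (z ⊗ c) n) ⟩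
           -- The coefficient 2 in `θ` splits into the equal summands for j = M + 1 and j = -(M +
           -- 1).
           -1ℤ ^ suc M * (+ 2 * (z ⊗ c) n)               ≡⟨ double (-1ℤ ^ suc M) ((z ⊗ c) n) ⟩
           -1ℤ ^ suc M * (z ⊗ c) n ℤ.+ -1ℤ ^ suc M * (z ⊗ c) n
             ≡⟨ cong₂ ℤ._+_ (summand≡ (+ suc M)) (summand≡ -[1+ M ]) ⟨
           summand n (+ suc M) ℤ.+ summand n -[1+ M ] ∎) ⟩
    sumUpTo (suc M) (summand n) ∎
    where
    open ≡-Reasoning
    open Solver using (solve; _:+_; _:*_; _:=_)
    c z : Series
    c = cubicGF (n ℕ.* 2)
    z = q² ↑ (suc M ℕ.* suc M)
    double : ∀ i j → i * (+ 2 * j) ≡ i * j ℤ.+ i * j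
    double = +-*-Solver.solve 2 (λ i j → i S.:* (S.con (+ 2) S.:* j) S.:= i S.:* j S.:+ i S.:* j) refl
      where module S = +-*-Solver

theorem4p13 : (n : ℕ) →
    (λ (j : ℤ) → -1ℤ ^ ∣ j ∣ * + a (+ n - + 2 * j ^ 2)) SumsTo (+ pod n)
-- One n serves as support bound, truncation order and number of factors; coefficient n is the last
-- one that the truncation keeps.
theorem4p13 n = n , summand-vanish n , (begin
  sumUpTo n (summand n)                      ≡⟨ θ⊗cubic n n ⟨
  (θ q² n ⊗ cubicGF (n ℕ.* 2)) n             ≡⟨ coeff (pod≈θ⊗a n (podGF (n ℕ.* 2)) (cubicGF (n ℕ.* 2))
                                                  (q²↑-nilpotent ℕ.≤-refl) (podGF⊗E n) (cubicGF⊗O⁻EE n)) ℕ.≤-refl ⟨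
  podGF (n ℕ.* 2) n                          ≡⟨ pod-coeff n ⟩
  + pod n ∎)
  where
  open ≡-Reasoning
  open Truncated n
  open Gauss n
  open GeneratingFunctions n
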